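{- Consider an instance of the capacitated facility location problem (defined in the context) with facilities $F=\{1,\dots,m\}$ and clients $D=\{1,\dots,n\}$ whose transportation costs satisfy the Monge property $c_{hj}+c_{ik}\le c_{hk}+c_{ij}$ for all $1\le h<i\le m$, $1\le j<k\le n$ (with $a+\infty=\infty$). For $i\in\{1,\dots,m+1\}$ and integer budget $b\ge 0$, let $V_i(b)$ be the maximum total amount of demand that can be served by opening only facilities among $i,i+1,\dots,m$, with total cost (opening plus transportation) at most $b$, subject to capacities, and such that the served demand is filled "right to left": if any demand of client $j$ is served then all demand of every client $j'>j$ is served. Then $V_{m+1}(b)=0$ and for $1\le i\le m$, $$V_i(b)=\max_{b'\in\mathbb{Z},\,0\le b'\le b}\Big(V_{i+1}(b')+\mathrm{DM}(i,V_{i+1}(b'),b-b')\Big).$$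
   Context: Capacitated facility location: a set $D$ of clients, a set $F$ of facilities, an opening cost $f_i\ge 0$ and integer capacity $U_i$ for each $i\in F$, an integer demand $d_j>0$ for each $j\in D$, and a per-unit transportation cost $c_{ij}\in\mathbb{Z}_{\ge0}\cup\{\infty\}$ for serving client $j$ from facility $i$. A solution opens a set $F'\subseteq F$ and assigns fractions $x_{ij}\in[0,1]$ ($x_{ij}>0$ only if $i\in F'$) with $\sum_j x_{ij}d_j\le U_i$; its cost is $\sum_{i\in F'}f_i+\sum_{i,j}c_{ij}d_jx_{ij}$. Helper function $\mathrm{DM}(i,d,\beta)$: suppose $d$ units of demand have been served right to left (i.e. clients $n,n-1,\dots$ are fully served in that order, with possibly one client partially served), leaving remaining demands $\bar d_j(i,d)$ at each client. If $f_i\le\beta$, facility $i$ is opened, its opening cost $f_i$ is subtracted from the budget, and facility $i$ serves the remaining demands continuing right to left (from $j=n$ downward), paying $c_{ij}$ per unit served of client $j$, until the remaining budget $\beta-f_i$ is used up, its capacity $U_i$ is reached, or all demand is served; $\mathrm{DM}(i,d,\beta)$ is the amount of demand so served (and it is $0$ if $f_i>\beta$).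
   Formalization: Opening costs are taken to be integers, and served amounts (V and DM) are counted in whole units, with rational assignment fractions; with non-integer opening costs or fractional amounts of demand the recursion over integer b' is false. -}

module Defs where

open import Data.Bool.Base using (if_then_else_)
open import Data.Fin.Base using (Fin; toℕ) renaming (_<_ to _<ᶠ_)
open import Data.Fin.Properties using () renaming (_<?_ to _<ᶠ?_)
open import Data.Fin.Subset using (Subset; _∈_)
open import Data.Fin.Subset.Properties using (_∈?_)
open import Data.Integer.Base using (+_)
open import Data.List.Base using (List; []; _∷_; allFin; reverse)
open import Data.Maybe.Base using (zipWith)
open import Data.Nat.Base using (ℕ; zero; suc; _+_; _*_; _∸_; _⊓_; _/_; _≤_; _<_)
open import Data.Nat.Properties using (_≤?_; _<?_)
open import Data.Product.Base using (_×_; ∃-syntax)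
open import Data.Rational.Base as ℚ using (ℚ; 0ℚ; 1ℚ)
import Data.Rational.Properties as ℚₚ
open import Data.Vec.Functional using (foldr)
open import Relation.Binary.PropositionalEquality.Core using (_≡_)
open import Relation.Nullary.Construct.Add.Supremum using (_⁺; ⊤⁺; [_])
open import Relation.Nullary.Decidable.Core using (does)
import Algebra.Definitions.RawMonoid as RawMonoid
import Relation.Binary.Construct.Add.Supremum.NonStrict as AddSupremum

open RawMonoid ℚ.+-0-rawMonoid public using () renaming (sum to ∑ℚ)
open RawMonoid Data.Nat.Base.+-0-rawMonoid public using () renaming (sum to ∑ℕ)

open AddSupremum _≤_ public using () renaming (_≤⁺_ to _≤∞_)
open AddSupremum ℚ._≤_ public using () renaming (_≤⁺_ to _≤ℚ∞_)

infixl 6 _+∞_ _+ℚ∞_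

_+∞_ : ℕ ⁺ → ℕ ⁺ → ℕ ⁺
_+∞_ = zipWith _+_

_+ℚ∞_ : ℚ ⁺ → ℚ ⁺ → ℚ ⁺
_+ℚ∞_ = zipWith ℚ._+_

∑ℚ∞ : ∀ {n} → (Fin n → ℚ ⁺) → ℚ ⁺
∑ℚ∞ = foldr _+ℚ∞_ [ 0ℚ ]

fromℕ : ℕ → ℚ
fromℕ k = + k ℚ./ 1

-- Convention ∞ · 0 = 0: an unusable pair (i , j) carrying no flow costs nothing.
_·∞_ : ℕ ⁺ → ℚ → ℚ ⁺
[ c ] ·∞ q = [ fromℕ c ℚ.* q ]
⊤⁺    ·∞ q = if does (q ℚₚ.≟ 0ℚ) then [ 0ℚ ] else ⊤⁺

-- Opening costs are whole numbers, like all other data.  Over arbitrary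
-- f ≥ 0 the recursion, whose budget splits are integral, is false: with
-- f₁ = f₂ = 1/2, budget 1 opens both facilities, but neither b' = 0 nor
-- b' = 1 leaves both of them a budget of at least 1/2.
record CFL (m n : ℕ) : Set where
  field
    openingCost : Fin m → ℕ
    capacity    : Fin m → ℕ
    demand      : Fin n → ℕ
    demand>0    : ∀ j → 0 < demand j
    unitCost    : Fin m → Fin n → ℕ ⁺

IsMaximum : (ℕ → Set) → ℕ → Set
IsMaximum P v = P v × (∀ w → P w → w ≤ v)

module _ {m n : ℕ} (I : CFL m n) where
  open CFL I

  Monge : Set
  Monge = ∀ {h i : Fin m} {j k : Fin n} → h <ᶠ i → j <ᶠ k →
          (unitCost h j +∞ unitCost i k) ≤∞ (unitCost h k +∞ unitCost i j)

  -- Clients may be served partially or not at all: `covered` is an inequality.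
  record Solution : Set where
    field
      opened     : Subset m
      x          : Fin m → Fin n → ℚ
      x≥0        : ∀ i j → 0ℚ ℚ.≤ x i j
      x≤1        : ∀ i j → x i j ℚ.≤ 1ℚ
      x>0⇒opened : ∀ i j → 0ℚ ℚ.< x i j → i ∈ opened
      covered    : ∀ j → ∑ℚ (λ i → x i j) ℚ.≤ 1ℚ
      capacities : ∀ i → ∑ℚ (λ j → x i j ℚ.* fromℕ (demand j)) ℚ.≤ fromℕ (capacity i)

    served : Fin n → ℚ
    served j = ∑ℚ (λ i → x i j ℚ.* fromℕ (demand j))

    totalServed : ℚ
    totalServed = ∑ℚ served

    openingTotal : ℕ
    openingTotal = ∑ℕ (λ i → if does (i ∈? opened) then openingCost i else 0)

    transportTotal : ℚ ⁺
    transportTotal =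
      ∑ℚ∞ (λ i → ∑ℚ∞ (λ j → unitCost i j ·∞ (fromℕ (demand j) ℚ.* x i j)))

    cost : ℚ ⁺
    cost = [ fromℕ openingTotal ] +ℚ∞ transportTotal

    RightToLeft : Set
    RightToLeft = ∀ {j k} → j <ᶠ k → 0ℚ ℚ.< served j → served k ≡ fromℕ (demand k)

  open Solution

  -- t is a whole number of units, although the fractions x need not be
  -- integral.  Since demand can be dropped from the left at no cost, the
  -- maximum such t is the floor of the maximum over rational t.  Without this
  -- rounding the recursion is false: take f = 0, unit capacities and demands,
  -- c₁₁ = 2, c₁₂ = 0, c₂₁ = 3, c₂₂ = 1.  Budget 2 serves 5/3 units by letting
  -- facility 2 serve 2/3 of client 2 and facility 1 the rest, but this spends
  -- 2/3 on facility 2, and no integral split of the budget serves more than 3/2.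
  --
  -- Facilities are counted from 0, so i = m allows no facility at all.
  Servable : Fin (suc m) → ℕ → ℕ → Set
  Servable i b t = ∃[ S ]
    (∀ h → h ∈ opened S → toℕ i ≤ toℕ h)
    × RightToLeft S
    × totalServed S ≡ fromℕ t
    × cost S ≤ℚ∞ [ fromℕ b ]

  demandRightOf : Fin n → ℕ
  demandRightOf j = ∑ℕ (λ k → if does (j <ᶠ? k) then demand k else 0)

  -- The inner difference is what is left of d when client j's turn comes.
  remaining : ℕ → Fin n → ℕ
  remaining d j = demand j ∸ (d ∸ demandRightOf j)

  -- Largest number of units, at most r, that budget β buys at the given unit cost.
  affordable : ℕ ⁺ → ℕ → ℕ → ℕ
  affordable ⊤⁺        r β = 0
  affordable [ zero ]  r β = r
  affordable [ suc c ] r β = r ⊓ (β / suc c)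

  price : ℕ ⁺ → ℕ → ℕ
  price ⊤⁺    a = 0      -- never charged, as then a = 0
  price [ c ] a = c * a

  -- Serving stops at the first client that cannot be completed, even if
  -- clients further left are cheaper.
  serve : Fin m → (Fin n → ℕ) → List (Fin n) → (U β : ℕ) → ℕ
  serve i r []       U β = 0
  serve i r (j ∷ js) U β =
    if does (a <? r j)
    then a
    else a + serve i r js (U ∸ a) (β ∸ price (unitCost i j) a)
    where
    a : ℕ
    a = affordable (unitCost i j) (r j ⊓ U) β

  DM : Fin m → (d β : ℕ) → ℕ
  DM i d β =
    if does (openingCost i ≤? β)
    then serve i (remaining d) (reverse (allFin n)) (capacity i) (β ∸ openingCost i)
    else 0

{-# OPTIONS --safe #-}
-- Write a solution as the list of the facilities serving the successive units
-- of demand, from right to left.  By the Monge property, swapping two adjacent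
-- entries that are in increasing order never raises the cost, so the list may be
-- taken descending: facility i then serves the leftmost units served, and the
-- later facilities the units to their right.  If the later facilities can serve
-- more for the same money, facility i merely skips the first units of its share.
--
-- Fractions are removed by sampling.  With a common denominator N, list N-th
-- parts of units instead of units, and sort.  The N samples consisting of every
-- N-th entry share the total cost, so some sample costs at most the average; and
-- as each facility occupies an interval of at most N U positions, it occurs at
-- most U times in every sample.
module Submission where

open import Defs
open import Algebra.Bundles using (CommutativeRing)
open import Data.Bool.Base using (if_then_else_)
open import Data.Empty using (⊥; ⊥-elim)
open import Data.Fin.Base as Fin using (Fin; zero; suc; toℕ; inject₁) renaming (fromℕ to lastFin; _<_ to _<ᶠ_; _≤_ to _≤ᶠ_)
open import Data.Fin.Induction using (>-weakInduction)
open import Data.Fin.Properties as Fin using (_≟_) renaming (_<?_ to _<ᶠ?_)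
open import Data.Fin.Subset using (Subset; _∈_; _∉_; inside; outside) renaming (⊥ to ∅)
open import Data.Fin.Subset.Properties using (_∈?_; ∉⊥)
open import Data.Integer.Base as ℤ using (-[1+_]; +≤+; +<+)
import Data.Integer.Properties as ℤ
open import Data.List.Base using (List; []; _∷_; _++_; map; length; replicate; take; drop; tabulate; concatMap; allFin; reverse; upTo)
open import Data.List.Extrema.Nat using (max; v≤max⁺; argmax-sel)
open import Data.List.Membership.Propositional.Properties using (∈-map⁻; ∈-map⁺; ∈-upTo⁺; ∈-upTo⁻)
open import Data.List.Properties using (map-++; map-∘; map-tabulate; ++-assoc; ++-identityʳ; length-++; length-replicate; reverse-map; unfold-reverse; drop-[]; drop-drop; take++drop≡id)
open import Data.List.Relation.Binary.Permutation.Propositional using (_↭_; ↭-refl; ↭-sym; ↭-trans; prep; swap)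
open import Data.List.Relation.Binary.Permutation.Propositional.Properties using (All-resp-↭; ↭-length; ↭-reverse; map⁺)
open import Data.List.Relation.Unary.All as All using (All; []; _∷_)
import Data.List.Relation.Unary.All.Properties as All
open import Data.List.Relation.Unary.AllPairs as AllPairs using (AllPairs; []; _∷_)
import Data.List.Relation.Unary.AllPairs.Properties as AllPairs
open import Data.List.Relation.Unary.Any as Any using (Any)
open import Data.Nat.Base
open import Data.Nat.Coprimality as Coprime using (1-coprimeTo)
open import Data.Nat.DivMod using (m/n*n≤m; /-monoˡ-≤; m*n/n≡m)
open import Data.Nat.ListAction using (sum)
open import Data.Nat.ListAction.Properties using (sum-++; sum-↭)
open import Data.Nat.Properties hiding (_≟_)
open import Data.Product.Base using (_×_; _,_; ∃; ∃₂; ∃-syntax; proj₁; proj₂)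
open import Data.Rational.Base as ℚ using (ℚ; mkℚ; 0ℚ; 1ℚ; *≤*; *<*)
import Data.Rational.Properties as ℚ
import Data.Rational.Unnormalised.Base as ℚᵘ
import Data.Rational.Unnormalised.Properties as ℚᵘ
open import Data.Sum.Base using (_⊎_; inj₁; inj₂)
open import Data.Vec.Base using (_∷_; _[_]≔_; here; there)
open import Data.Vec.Properties using ([]≔-updates; []≔-minimal; []=⇒lookup; lookup⇒[]=; lookup∘update′; lookup∘update)
open import Function.Base using (_∘_; id)
open import Relation.Binary.Definitions using (tri<; tri≈; tri>)
open import Relation.Binary.PropositionalEquality using (_≡_; _≢_; refl; sym; trans; cong; cong₂; subst; module ≡-Reasoning)
open import Relation.Nullary.Construct.Add.Supremum using (_⁺; ⊤⁺; [_])
open import Relation.Nullary.Decidable using (Dec; does; yes; no; dec-true; dec-false)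
open import Algebra.Properties.CommutativeMonoid.Sum +-0-commutativeMonoid using (sum-cong-≗; ∑-distrib-+; ∑-comm; sum-replicate-zero)
open import Algebra.Properties.CommutativeSemigroup +-commutativeSemigroup using (x∙yz≈y∙xz; interchange)
open import Algebra.Properties.CommutativeSemigroup *-commutativeSemigroup using () renaming (x∙yz≈y∙xz to x*yz≡y*xz)
import Algebra.Properties.Semiring.Sum (CommutativeRing.semiring ℚ.+-*-commutativeRing) as ∑ℚ
import Relation.Binary.Construct.Add.Supremum.NonStrict as AddSupremum

-- Only pairs of finite cost enter an assignment, and a swap keeps this so: the Monge inequality
-- bounds the two new costs by a finite sum. Sampling has to keep servers and clients in step. A
-- client of demand `d` fills exactly `N * d` consecutive positions of the subdivided client list,
-- so every sample meets it exactly `d` times whatever its offset, and the sampled servers face the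
-- list of whole units again. All samples share the same open facilities, so only the payments are
-- averaged. A maximum over rational solutions thus becomes a maximum over lists, where the two
-- inequalities of the recursion amount to appending or cutting off the units of facility `i`. The
-- greedy amount `DM` is optimal there because `i` serves one contiguous run of units with a fixed
-- start, and a longer run contains the shorter ones. The matrices of naturals between solutions and
-- lists count `N`-th parts of units; `N` is a common denominator on the way to lists and 1 on the
-- way back.

replicate-+ : ∀ {A : Set} a b {x : A} → replicate (a + b) x ≡ replicate a x ++ replicate b x
replicate-+ zero    b = refl
replicate-+ (suc a) b = cong (_ ∷_) (replicate-+ a b)

-- Unit assignments and sorting by Monge exchanges

Costs : ℕ → ℕ → Set
Costs m n = Fin m → Fin n → ℕ ⁺

-- The p-th facility of the first list serves one unit of the p-th client
-- of the second list, at the p-th cost of the third; clients may be left over.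
data Assignment {m n} (c : Costs m n) : List (Fin m) → List (Fin n) → List ℕ → Set where
  []  : ∀ {ks} → Assignment c [] ks []
  _∷_ : ∀ {i k w is ks ws} → c i k ≡ [ w ] → Assignment c is ks ws →
        Assignment c (i ∷ is) (k ∷ ks) (w ∷ ws)

module _ {m n} {c : Costs m n} where

  assign-++ : ∀ {is is′ ks ws ws′} → Assignment c is ks ws →
              Assignment c is′ (drop (length is) ks) ws′ →
              Assignment c (is ++ is′) ks (ws ++ ws′)
  assign-++ []      B = B
  assign-++ (e ∷ A) B = e ∷ assign-++ A B

  assign-split : ∀ is {is′ ks vs} → Assignment c (is ++ is′) ks vs →
                 ∃₂ λ ws ws′ → vs ≡ ws ++ ws′ × Assignment c is ks ws ×
                 Assignment c is′ (drop (length is) ks) ws′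
  assign-split []       A       = _ , _ , refl , [] , A
  assign-split (i ∷ is) (e ∷ A) with _ , _ , refl , B , B′ ← assign-split is A =
    _ , _ , refl , e ∷ B , B′

Descending : ∀ {n} → List (Fin n) → Set
Descending = AllPairs Fin._≥_

module _ {m n} {c : Costs m n}
  (monge : ∀ {h i j k} → h <ᶠ i → j <ᶠ k → (c h j +∞ c i k) ≤∞ (c h k +∞ c i j)) where

  -- The Monge property speaks of distinct clients only; when both units belong to the same client,
  -- the swap merely exchanges the two payments. For distinct clients the right side of the
  -- inequality is finite, which rules out `⊤⁺` for both new pairs.
  swap-≤ : ∀ {h i j k w w′} → h <ᶠ i → j ≤ᶠ k → c h k ≡ [ w ] → c i j ≡ [ w′ ] →
           ∃₂ λ v v′ → c i k ≡ [ v ] × c h j ≡ [ v′ ] × v + v′ ≤ w + w′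
  swap-≤ {h} {i} {j} {k} {w} {w′} h<i j≤k e e′ with Fin.<-cmp j k
  ... | tri> _ _ j>k = ⊥-elim (<⇒≱ j>k j≤k)
  ... | tri≈ _ refl _ = w′ , w , e′ , e , ≤-reflexive (+-comm w′ w)
  ... | tri< j<k _ _ with c h j | c i k | c h k | c i j | monge h<i j<k | e | e′
  ...   | [ v′ ] | [ v ] | _ | _ | AddSupremum.[ p ] | refl | refl =
    v , v′ , refl , refl , ≤-trans (≤-reflexive (+-comm v v′)) p

  -- One insertion of insertion sort: `i` moves past the larger entries. The clients stay where they
  -- are, so each move is a single exchange of neighbouring servers.
  insert-≤ : ∀ {i is ks ws} → Descending ks → Descending is → Assignment c (i ∷ is) ks ws →
             ∃₂ λ is′ ws′ → is′ ↭ i ∷ is × Descending is′ ×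
             Assignment c is′ ks ws′ × sum ws′ ≤ sum ws
  insert-≤ _ [] A = _ , _ , ↭-refl , [] ∷ [] , A , ≤-refl
  insert-≤ {i} {h ∷ is} _ (h≥ ∷ D) A with h Fin.≤? i
  ... | yes h≤i = _ , _ , ↭-refl , (h≤i ∷ All.map (λ p → ≤-trans p h≤i) h≥) ∷ h≥ ∷ D , A , ≤-refl
  insert-≤ {i} {h ∷ is} ((j≤k ∷ _) ∷ Dk) (h≥ ∷ D) (_∷_ {w = w} e (_∷_ {w = w′} {ws = ws} e′ A)) | no h≰i
    with v , v′ , f , f′ , le ← swap-≤ (≰⇒> h≰i) j≤k e e′
    with is′ , ws′ , perm , D′ , A′ , le′ ← insert-≤ Dk D (f′ ∷ A) =
    h ∷ is′ , v ∷ ws′ , ↭-trans (prep h perm) (swap h i ↭-refl) ,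
    All-resp-↭ (↭-sym perm) (<⇒≤ (≰⇒> h≰i) ∷ h≥) ∷ D′ , f ∷ A′ , (begin
      v + sum ws′         ≤⟨ +-monoʳ-≤ v le′ ⟩
      v + (v′ + sum ws)   ≡⟨ +-assoc v v′ _ ⟨
      v + v′ + sum ws     ≤⟨ +-monoˡ-≤ _ le ⟩
      w + w′ + sum ws     ≡⟨ +-assoc w w′ _ ⟩
      w + (w′ + sum ws)   ∎)
    where open ≤-Reasoning

  sort-≤ : ∀ {is ks ws} → Descending ks → Assignment c is ks ws →
           ∃₂ λ is′ ws′ → is′ ↭ is × Descending is′ ×
           Assignment c is′ ks ws′ × sum ws′ ≤ sum ws
  sort-≤ _ [] = [] , [] , ↭-refl , [] , [] , ≤-refl
  sort-≤ Dk@(_ ∷ Dk′) (_∷_ {i = i} {w = w} e A)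
    with is′ , ws′ , perm , D , A′ , le ← sort-≤ Dk′ A
    with is″ , ws″ , perm′ , D′ , A″ , le′ ← insert-≤ Dk D (e ∷ A′) =
    is″ , ws″ , ↭-trans perm′ (prep i perm) , D′ , A″ , ≤-trans le′ (+-monoʳ-≤ w le)

-- Counting occurrences and sampling every N-th entry, where N is `suc M`

δ : ∀ {n} → Fin n → Fin n → ℕ
δ h i = if does (h ≟ i) then 1 else 0

δ-refl : ∀ {n} (h : Fin n) → δ h h ≡ 1
δ-refl h with h ≟ h
... | yes _  = refl
... | no h≢h = ⊥-elim (h≢h refl)

δ-≢ : ∀ {n} {h i : Fin n} → h ≢ i → δ h i ≡ 0
δ-≢ {h = h} {i} h≢i with h ≟ i
... | yes h≡i = ⊥-elim (h≢i h≡i)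
... | no _    = refl

count : ∀ {n} → Fin n → List (Fin n) → ℕ
count h is = sum (map (δ h) is)

count-++ : ∀ {n} (h : Fin n) is is′ → count h (is ++ is′) ≡ count h is + count h is′
count-++ h is is′ = trans (cong sum (map-++ (δ h) is is′)) (sum-++ (map (δ h) is) _)

count-none : ∀ {n} {h : Fin n} {is} → All (h ≢_) is → count h is ≡ 0
count-none []        = refl
count-none (h≢ ∷ hs) = cong₂ _+_ (δ-≢ h≢) (count-none hs)

count-replicate : ∀ {n} (h i : Fin n) a → count h (replicate a i) ≡ a * δ h i
count-replicate h i zero    = refl
count-replicate h i (suc a) = cong (δ h i +_) (count-replicate h i a)

-- The elements at positions r, r + (M + 1), r + 2(M + 1), …
sample : {A : Set} → ℕ → ℕ → List A → List A
sample M r       []       = []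
sample M zero    (x ∷ xs) = x ∷ sample M M xs
sample M (suc r) (x ∷ xs) = sample M r xs

module _ {A : Set} (M : ℕ) where

  sample-All : ∀ {P : A → Set} r {xs} → All P xs → All P (sample M r xs)
  sample-All r       []       = []
  sample-All zero    (p ∷ ps) = p ∷ sample-All M ps
  sample-All (suc r) (p ∷ ps) = sample-All r ps

  sample-replicate-skip : ∀ a r {x : A} {xs} →
    sample M (a + r) (replicate a x ++ xs) ≡ sample M r xs
  sample-replicate-skip zero    r = refl
  sample-replicate-skip (suc a) r = sample-replicate-skip a r

  sample-replicate-hit : ∀ r e {x : A} {xs} →
    sample M r (replicate (r + suc e) x ++ xs) ≡ x ∷ sample M M (replicate e x ++ xs)
  sample-replicate-hit zero    e = refl
  sample-replicate-hit (suc r) e = sample-replicate-hit r e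

  -- Among `suc M` consecutive positions exactly one is sampled, and the offset into what follows is
  -- `r` again. This periodicity is what makes the result on whole blocks independent of the offset.
  sample-block : ∀ {r} {x : A} {xs} → r ≤ M →
    sample M r (replicate (suc M) x ++ xs) ≡ x ∷ sample M r xs
  sample-block {r} {x} {xs} r≤M = begin
    sample M r (replicate (suc M) x ++ xs)
      ≡⟨ cong (λ a → sample M r (replicate a x ++ xs)) (trans (cong suc (sym (m+[n∸m]≡n r≤M))) (sym (+-suc r _))) ⟩
    sample M r (replicate (r + suc (M ∸ r)) x ++ xs)     ≡⟨ sample-replicate-hit r (M ∸ r) ⟩
    x ∷ sample M M (replicate (M ∸ r) x ++ xs)
      ≡⟨ cong (λ s → x ∷ sample M s (replicate (M ∸ r) x ++ xs)) (m∸n+n≡m r≤M) ⟨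
    x ∷ sample M (M ∸ r + r) (replicate (M ∸ r) x ++ xs) ≡⟨ cong (x ∷_) (sample-replicate-skip (M ∸ r) r) ⟩
    x ∷ sample M r xs                                    ∎
    where open ≡-Reasoning

  sample-replicate : ∀ {r} d {x : A} {xs} → r ≤ M →
    sample M r (replicate (suc M * d) x ++ xs) ≡ replicate d x ++ sample M r xs
  sample-replicate {r} zero {x} {xs} r≤M = cong (λ a → sample M r (replicate a x ++ xs)) (*-zeroʳ (suc M))
  sample-replicate {r} (suc d) {x} {xs} r≤M = begin
    sample M r (replicate (suc M * suc d) x ++ xs)
      ≡⟨ cong (λ a → sample M r (replicate a x ++ xs)) (*-suc (suc M) d) ⟩
    sample M r (replicate (suc M + suc M * d) x ++ xs)
      ≡⟨ cong (λ ys → sample M r (ys ++ xs)) (replicate-+ (suc M) (suc M * d)) ⟩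
    sample M r ((replicate (suc M) x ++ replicate (suc M * d) x) ++ xs)
      ≡⟨ cong (sample M r) (++-assoc (replicate (suc M) x) _ _) ⟩
    sample M r (replicate (suc M) x ++ replicate (suc M * d) x ++ xs)         ≡⟨ sample-block r≤M ⟩
    x ∷ sample M r (replicate (suc M * d) x ++ xs)                            ≡⟨ cong (x ∷_) (sample-replicate d r≤M) ⟩
    x ∷ replicate d x ++ sample M r xs                                        ∎
    where
    open ≡-Reasoning

  length-sample-cong : ∀ {B : Set} r (xs : List A) (ys : List B) → length xs ≡ length ys →
    length (sample M r xs) ≡ length (sample M r ys)
  length-sample-cong r       []       []       e = refl
  length-sample-cong zero    (x ∷ xs) (y ∷ ys) e = cong suc (length-sample-cong M xs ys (suc-injective e))
  length-sample-cong (suc r) (x ∷ xs) (y ∷ ys) e = length-sample-cong r xs ys (suc-injective e)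

-- Sampling looks only at positions, so the length can be computed on a constant list, which
-- `sample-replicate` evaluates.
length-sample : ∀ {A : Set} M {r} t {xs : List A} → r ≤ M → length xs ≡ suc M * t →
                length (sample M r xs) ≡ t
length-sample M {r} t {xs} r≤M e = begin
  length (sample M r xs)
    ≡⟨ length-sample-cong M r xs (replicate (suc M * t) 0 ++ []) (trans e (sym (trans (cong length (++-identityʳ (replicate (suc M * t) 0))) (length-replicate (suc M * t))))) ⟩
  length (sample M r (replicate (suc M * t) 0 ++ []))         ≡⟨ cong length (sample-replicate M t {0} {[]} r≤M) ⟩
  length (replicate t 0 ++ sample M r [])                     ≡⟨ cong length (++-identityʳ (replicate t 0)) ⟩
  length (replicate t 0)                                      ≡⟨ length-replicate t ⟩
  t                                                           ∎
  where open ≡-Reasoning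

expand : ∀ {A : Set} → (A → ℕ) → List A → List A
expand d = concatMap (λ x → replicate (d x) x)

sample-expand : ∀ {A : Set} M {r} (d : A → ℕ) xs → r ≤ M →
                sample M r (expand (λ x → suc M * d x) xs) ≡ expand d xs
sample-expand M d []       r≤M = refl
sample-expand M d (x ∷ xs) r≤M =
  trans (sample-replicate M (d x) r≤M) (cong (replicate (d x) x ++_) (sample-expand M d xs r≤M))

assign-sample : ∀ {m n} {c : Costs m n} M r {is ks ws} → Assignment c is ks ws →
                Assignment c (sample M r is) (sample M r ks) (sample M r ws)
assign-sample M r       []      = []
assign-sample M zero    (e ∷ A) = e ∷ assign-sample M M A
assign-sample M (suc r) (e ∷ A) = assign-sample M r A

-- In a descending list the copies of h are contiguous, so between the first
-- and the last sampled copy lie only copies of h.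
count-sample : ∀ {n} M r (h : Fin n) {is} → r ≤ M → Descending is →
               suc M * count h (sample M r is) ≤ count h is + M
count-sample M r h {[]} r≤M [] = ≤-trans (≤-reflexive (*-zeroʳ (suc M))) z≤n
count-sample {n} M r h {i ∷ is} r≤M (i≥ ∷ D) with Fin.<-cmp h i
... | tri> _ h≢i i<h = ≤-trans (≤-reflexive (trans (cong (suc M *_) (count-none (sample-All M r
          (h≢i ∷ All.map (λ p → Fin.<⇒≢ (≤-<-trans p i<h) ∘ sym) i≥)))) (*-zeroʳ (suc M)))) z≤n
... | tri< h<i h≢i _ = skipped r r≤M
  where
  skipped : ∀ r → r ≤ M → suc M * count h (sample M r (i ∷ is)) ≤ δ h i + count h is + M
  skipped zero    _   rewrite δ-≢ h≢i = count-sample M M h ≤-refl D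
  skipped (suc r) r<M rewrite δ-≢ h≢i = count-sample M r h (<⇒≤ r<M) D
... | tri≈ _ refl _ = ≤-trans (run r r≤M (≤-refl ∷ i≥) (i≥ ∷ D)) (+-monoʳ-≤ (count h (h ∷ is)) (m∸n≤m M r))
  where
  open ≤-Reasoning
  -- The slack `M ∸ r` is an invariant of the walk through the copies of `h`: a skipped copy lowers
  -- the count by one and raises the slack by one, while a sampled copy uses up itself and a full
  -- slack of `M`, together `suc M`.
  run : ∀ {is} r → r ≤ M → All (Fin._≤ h) is → Descending is →
        suc M * count h (sample M r is) ≤ count h is + (M ∸ r)
  run {[]} r r≤M _ _ = ≤-trans (≤-reflexive (*-zeroʳ (suc M))) z≤n
  run {i ∷ is} r r≤M (i≤h ∷ ≤h) (i≥ ∷ D) with h ≟ i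
  ... | no h≢i = ≤-trans (≤-reflexive (trans (cong (suc M *_) (count-none (sample-All M r
          (h≢i ∷ All.map (λ p → Fin.<⇒≢ (≤-<-trans p (Fin.≤∧≢⇒< i≤h (h≢i ∘ sym))) ∘ sym) i≥)))) (*-zeroʳ (suc M)))) z≤n
  run {i ∷ is} zero r≤M (i≤h ∷ ≤h) (i≥ ∷ D) | yes refl rewrite δ-refl h = begin
    suc M * (1 + count h (sample M M is))     ≡⟨ *-suc (suc M) _ ⟩
    suc M + suc M * count h (sample M M is)   ≤⟨ +-monoʳ-≤ (suc M) (run M ≤-refl ≤h D) ⟩
    suc M + (count h is + (M ∸ M))            ≡⟨ cong (λ z → suc M + (count h is + z)) (n∸n≡0 M) ⟩
    suc M + (count h is + 0)                  ≡⟨ cong (suc M +_) (+-identityʳ _) ⟩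
    suc M + count h is                        ≡⟨ cong suc (+-comm M (count h is)) ⟩
    suc (count h is) + M                      ∎
  run {i ∷ is} (suc r) r<M (i≤h ∷ ≤h) (i≥ ∷ D) | yes refl = begin
    suc M * count h (sample M r is)           ≤⟨ run r (<⇒≤ r<M) ≤h D ⟩
    count h is + (M ∸ r)                      ≡⟨ cong (count h is +_) (+-∸-assoc 1 r<M) ⟩
    count h is + suc (M ∸ suc r)              ≡⟨ +-suc (count h is) _ ⟩
    suc (count h is) + (M ∸ suc r)            ∎

samples-sum : ℕ → ℕ → List ℕ → ℕ
samples-sum M zero    ws = sum (sample M 0 ws)
samples-sum M (suc k) ws = samples-sum M k ws + sum (sample M (suc k) ws)

-- Prepending `w` shifts the offsets: offset 0 now reads `w` and then the old offset `M`, and offset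
-- `suc r` reads the old offset `r`. The old offset `k` is the one missing on the left, hence the
-- added term; for `k` equal to `M` it cancels.
samples-sum-∷ : ∀ M k w ws → samples-sum M k (w ∷ ws) + sum (sample M k ws) ≡
                w + (sum (sample M M ws) + samples-sum M k ws)
samples-sum-∷ M zero    w ws = +-assoc w _ _
samples-sum-∷ M (suc k) w ws = trans (cong (_+ sum (sample M (suc k) ws)) (samples-sum-∷ M k w ws))
  (lemma w (sum (sample M M ws)) (samples-sum M k ws) (sum (sample M (suc k) ws)))
  where
  lemma : ∀ a b c d → a + (b + c) + d ≡ a + (b + (c + d))
  lemma a b c d = trans (+-assoc a (b + c) d) (cong (a +_) (+-assoc b c d))

samples-sum-all : ∀ M ws → samples-sum M M ws ≡ sum ws
samples-sum-all M []       = zeros M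
  where
  zeros : ∀ k → samples-sum M k [] ≡ 0
  zeros zero    = refl
  zeros (suc k) = cong (_+ 0) (zeros k)
samples-sum-all M (w ∷ ws) = +-cancelʳ-≡ (sum (sample M M ws)) _ _ (begin
  samples-sum M M (w ∷ ws) + sum (sample M M ws)    ≡⟨ samples-sum-∷ M M w ws ⟩
  w + (sum (sample M M ws) + samples-sum M M ws)
    ≡⟨ cong (λ s → w + (sum (sample M M ws) + s)) (samples-sum-all M ws) ⟩
  w + (sum (sample M M ws) + sum ws)                ≡⟨ cong (w +_) (+-comm _ (sum ws)) ⟩
  w + (sum ws + sum (sample M M ws))                ≡⟨ +-assoc w _ _ ⟨
  w + sum ws + sum (sample M M ws)                  ∎)
  where open ≡-Reasoning

-- The least of `suc k` numbers is at most their average, multiplied out to avoid division.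
cheap-sample : ∀ M k ws → ∃[ r ] r ≤ k × suc k * sum (sample M r ws) ≤ samples-sum M k ws
cheap-sample M zero    ws = 0 , z≤n , ≤-reflexive (*-identityˡ _)
cheap-sample M (suc k) ws
  with r , r≤k , le ← cheap-sample M k ws
  with ≤-total (sum (sample M r ws)) (sum (sample M (suc k) ws))
... | inj₁ p = r , m≤n⇒m≤1+n r≤k , (begin
  suc (suc k) * sum (sample M r ws)                                  ≡⟨ +-comm (sum (sample M r ws)) _ ⟩
  suc k * sum (sample M r ws) + sum (sample M r ws)                  ≤⟨ +-mono-≤ le p ⟩
  samples-sum M k ws + sum (sample M (suc k) ws)                     ∎)
  where open ≤-Reasoning
... | inj₂ p = suc k , ≤-refl , (begin
  suc (suc k) * sum (sample M (suc k) ws)                            ≡⟨ +-comm (sum (sample M (suc k) ws)) _ ⟩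
  suc k * sum (sample M (suc k) ws) + sum (sample M (suc k) ws)      ≤⟨ +-monoˡ-≤ _ (≤-trans (*-monoʳ-≤ (suc k) p) le) ⟩
  samples-sum M k ws + sum (sample M (suc k) ws)                     ∎)
  where open ≤-Reasoning

-- Greedy service by a single facility

module _ {m n : ℕ} (I : CFL m n) where
  open CFL I

  affordable-≤ : ∀ c r β → affordable I c r β ≤ r
  affordable-≤ ⊤⁺        r β = z≤n
  affordable-≤ [ zero ]  r β = ≤-refl
  affordable-≤ [ suc c ] r β = m⊓n≤m r _

  price-affordable-≤ : ∀ c r β → price I c (affordable I c r β) ≤ β
  price-affordable-≤ ⊤⁺        r β = z≤n
  price-affordable-≤ [ zero ]  r β = z≤n
  price-affordable-≤ [ suc c ] r β = begin
    suc c * (r ⊓ (β / suc c))   ≤⟨ *-monoʳ-≤ (suc c) (m⊓n≤n r _) ⟩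
    suc c * (β / suc c)       ≡⟨ *-comm (suc c) _ ⟩
    β / suc c * suc c         ≤⟨ m/n*n≤m β (suc c) ⟩
    β                         ∎
    where open ≤-Reasoning

  affordable-finite : ∀ c r β → 0 < affordable I c r β → ∃[ w ] c ≡ [ w ]
  affordable-finite [ w ] r β _ = w , refl

  affordable-max : ∀ c {a r β} → (0 < a → ∃[ w ] c ≡ [ w ]) → a ≤ r → price I c a ≤ β →
                   a ≤ affordable I c r β
  affordable-max ⊤⁺        {zero}  _ _ _ = z≤n
  affordable-max ⊤⁺        {suc a} fin _ _ with () ← proj₂ (fin z<s)
  affordable-max [ zero ]  _ a≤r _ = a≤r
  affordable-max [ suc c ] {a} {r} {β} _ a≤r le = ⊓-glb a≤r (begin
    a                    ≡⟨ m*n/n≡m a (suc c) ⟨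
    a * suc c / suc c    ≤⟨ /-monoˡ-≤ (suc c) (≤-trans (≤-reflexive (*-comm a (suc c))) le) ⟩
    β / suc c            ∎)
    where open ≤-Reasoning

  assign-block : ∀ {i k a b ks} → (0 < a → ∃[ w ] unitCost i k ≡ [ w ]) → a ≤ b →
    ∃[ ws ] Assignment unitCost (replicate a i) (replicate b k ++ ks) ws ×
            sum ws ≡ price I (unitCost i k) a
  assign-block {i} {k} {zero} _ _ = [] , [] , sym (price-zero (unitCost i k))
    where
    price-zero : ∀ c → price I c 0 ≡ 0
    price-zero ⊤⁺    = refl
    price-zero [ c ] = *-zeroʳ c
  assign-block {i} {k} {suc a} fin (s≤s a≤b) with w , e ← fin z<s
    with ws , A , eq ← assign-block {i} {k} {a} (λ _ → w , e) a≤b =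
    w ∷ ws , e ∷ A , trans (cong (w +_) eq) (price-suc e)
    where
    price-suc : ∀ {c} → c ≡ [ w ] → w + price I c a ≡ price I c (suc a)
    price-suc refl = sym (*-suc w a)

  -- Servers and clients determine the payments, so their sum can be read off the assignment that
  -- `assign-block` constructs.
  assign-block⁻ : ∀ {i k a b ks ws} → Assignment unitCost (replicate a i) (replicate b k ++ ks) ws →
    a ≤ b → (0 < a → ∃[ w ] unitCost i k ≡ [ w ]) × sum ws ≡ price I (unitCost i k) a
  assign-block⁻ {i} {k} {zero} [] _ = (λ ()) , proj₂ (proj₂ (assign-block {i} {k} {0} {0} {[]} (λ ()) z≤n))
  assign-block⁻ {i} {k} {suc a} {suc b} {ks} (e ∷ A) (s≤s a≤b)
    with ws , A′ , eq ← assign-block {i} {k} {suc a} {suc b} {ks} (λ _ → _ , e) (s≤s a≤b) =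
    (λ _ → _ , e) , trans (cong sum (unique (e ∷ A) A′)) eq
    where
    unique : ∀ {is ks vs ws} → Assignment unitCost is ks vs → Assignment unitCost is ks ws → vs ≡ ws
    unique []      []       = refl
    unique (e ∷ A) (e′ ∷ B) with refl ← trans (sym e) e′ = cong (_ ∷_) (unique A B)

drop-replicate : ∀ {A : Set} s b {x : A} {xs} →
                 drop s (replicate b x ++ xs) ≡ replicate (b ∸ s) x ++ drop (s ∸ b) xs
drop-replicate zero    b       rewrite 0∸n≡0 b = refl
drop-replicate (suc s) zero    = refl
drop-replicate (suc s) (suc b) = drop-replicate s b

drop-block : ∀ {A B : Set} (i : B) a {x : A} {xs} → drop (length (replicate a i)) (replicate a x ++ xs) ≡ xs
drop-block i a {x} {xs} = begin
  drop (length (replicate a i)) (replicate a x ++ xs)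
    ≡⟨ cong (λ l → drop l (replicate a x ++ xs)) (length-replicate a) ⟩
  drop a (replicate a x ++ xs)                          ≡⟨ drop-replicate a a ⟩
  replicate (a ∸ a) x ++ drop (a ∸ a) xs                ≡⟨ cong (λ e → replicate e x ++ drop e xs) (n∸n≡0 a) ⟩
  xs                                                    ∎
  where open ≡-Reasoning

module _ {m n} {c : Costs m n} {i : Fin m} {k : Fin n} {a e : ℕ} {ks : List (Fin n)} where

  assign-block-++ : ∀ {ws ws′} → Assignment c (replicate a i) (replicate a k ++ ks) ws →
    Assignment c (replicate e i) ks ws′ →
    Assignment c (replicate (a + e) i) (replicate a k ++ ks) (ws ++ ws′)
  assign-block-++ {ws} {ws′} A B =
    subst (λ is → Assignment c is (replicate a k ++ ks) (ws ++ ws′)) (sym (replicate-+ a e))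
      (assign-++ A (subst (λ ks → Assignment c (replicate e i) ks ws′) (sym (drop-block i a)) B))

  assign-block-split : ∀ {vs} → Assignment c (replicate (a + e) i) (replicate a k ++ ks) vs →
    ∃₂ λ ws ws′ → vs ≡ ws ++ ws′ × Assignment c (replicate a i) (replicate a k ++ ks) ws ×
    Assignment c (replicate e i) ks ws′
  assign-block-split {vs} A
    with ws , ws′ , eq , B , B′ ← assign-split (replicate a i)
           (subst (λ is → Assignment c is (replicate a k ++ ks) vs) (replicate-+ a e) A) =
    ws , ws′ , eq , B , subst (λ ks → Assignment c (replicate e i) ks ws′) (drop-block i a) B′

module _ {m n : ℕ} (I : CFL m n) (i : Fin m) (r : Fin n → ℕ) where
  open CFL I

  private
    bought : Fin n → ℕ → ℕ → ℕ
    bought j U β = affordable I (unitCost i j) (r j ⊓ U) β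

    continued : Fin n → List (Fin n) → ℕ → ℕ → ℕ
    continued j js U β = bought j U β + serve I i r js (U ∸ bought j U β) (β ∸ price I (unitCost i j) (bought j U β))

  serve-stop : ∀ j js {U β} → bought j U β < r j → serve I i r (j ∷ js) U β ≡ bought j U β
  serve-stop j js {U} {β} lt = cong (λ b → if b then bought j U β else continued j js U β) (dec-true (bought j U β <? r j) lt)

  serve-go : ∀ j js {U β} → r j ≤ bought j U β → serve I i r (j ∷ js) U β ≡
             r j + serve I i r js (U ∸ r j) (β ∸ price I (unitCost i j) (r j))
  serve-go j js {U} {β} ge = begin
    serve I i r (j ∷ js) U β
      ≡⟨ cong (λ b → if b then bought j U β else continued j js U β) (dec-false (bought j U β <? r j) (≤⇒≯ ge)) ⟩
    bought j U β + serve I i r js (U ∸ bought j U β) (β ∸ price I (unitCost i j) (bought j U β))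
      ≡⟨ cong (λ a → a + serve I i r js (U ∸ a) (β ∸ price I (unitCost i j) a)) full ⟩
    r j + serve I i r js (U ∸ r j) (β ∸ price I (unitCost i j) (r j)) ∎
    where
    open ≡-Reasoning
    full : bought j U β ≡ r j
    full = ≤-antisym (≤-trans (affordable-≤ I (unitCost i j) _ β) (m⊓n≤m (r j) U)) ge

  -- The served units form an initial run of the expanded list: `serve` moves on to the next client
  -- only when the current one is complete, so no gap arises between the blocks.
  serve-sound : ∀ js U β → ∃[ ws ]
    Assignment unitCost (replicate (serve I i r js U β) i) (expand r js) ws ×
    sum ws ≤ β × serve I i r js U β ≤ U
  serve-sound []       U β = [] , [] , z≤n , z≤n
  serve-sound (j ∷ js) U β with ≤-<-connex (r j) (bought j U β)
  ... | inj₂ lt rewrite serve-stop j js {U} {β} lt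
    with ws , A , eq ← assign-block I {i} {j} {bought j U β} {r j} {expand r js}
                         (affordable-finite I (unitCost i j) (r j ⊓ U) β) (<⇒≤ lt) =
    ws , A , ≤-trans (≤-reflexive eq) (price-affordable-≤ I (unitCost i j) _ β) ,
    ≤-trans (affordable-≤ I (unitCost i j) _ β) (m⊓n≤n (r j) U)
  ... | inj₁ ge rewrite serve-go j js {U} {β} ge
    with ws , A , eq ← assign-block I {i} {j} {r j} {r j} {expand r js}
           (λ lt → affordable-finite I (unitCost i j) (r j ⊓ U) β (≤-trans lt ge)) ≤-refl
    with ws′ , A′ , le , s≤ ← serve-sound js (U ∸ r j) (β ∸ price I (unitCost i j) (r j)) =
    ws ++ ws′ ,
    assign-block-++ A A′ ,
    (begin
      sum (ws ++ ws′)                                                              ≡⟨ sum-++ ws ws′ ⟩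
      sum ws + sum ws′                                                             ≤⟨ +-mono-≤ (≤-reflexive eq) le ⟩
      price I (unitCost i j) (r j) + (β ∸ price I (unitCost i j) (r j))            ≡⟨ m+[n∸m]≡n paid ⟩
      β                                                                            ∎) ,
    ≤-trans (+-monoʳ-≤ (r j) s≤) (≤-reflexive (m+[n∸m]≡n room))
    where
    open ≤-Reasoning
    full : bought j U β ≡ r j
    full = ≤-antisym (≤-trans (affordable-≤ I (unitCost i j) _ β) (m⊓n≤m (r j) U)) ge
    paid : price I (unitCost i j) (r j) ≤ β
    paid = subst (λ a → price I (unitCost i j) a ≤ β) full (price-affordable-≤ I (unitCost i j) (r j ⊓ U) β)
    room : r j ≤ U
    room = ≤-trans ge (≤-trans (affordable-≤ I (unitCost i j) _ β) (m⊓n≤n (r j) U))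

  -- A run that fits budget and capacity either ends within the first client, where `bought` is at
  -- least as long, or completes that client. In the second case `serve` completes it too, at the
  -- same price, and what is left of budget and capacity still covers the rest of the run.
  serve-max : ∀ js {a U β ws} → Assignment unitCost (replicate a i) (expand r js) ws →
              sum ws ≤ β → a ≤ U → a ≤ serve I i r js U β
  serve-max []       {zero} _ _ _ = z≤n
  serve-max (j ∷ js) {a} {U} {β} {ws} A le a≤U with ≤-total a (r j)
  ... | inj₁ a≤r = ≤-trans a≤bought bought≤serve
    where
    a≤bought : a ≤ bought j U β
    a≤bought with fin , eq ← assign-block⁻ I {i} {j} {a} {r j} {expand r js} A a≤r =
      affordable-max I (unitCost i j) fin (⊓-glb a≤r a≤U) (≤-trans (≤-reflexive (sym eq)) le)
    bought≤serve : bought j U β ≤ serve I i r (j ∷ js) U β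
    bought≤serve with ≤-<-connex (r j) (bought j U β)
    ... | inj₂ lt = ≤-reflexive (sym (serve-stop j js lt))
    ... | inj₁ ge = ≤-trans (≤-trans (affordable-≤ I (unitCost i j) _ β) (m⊓n≤m (r j) U))
                      (≤-trans (m≤m+n (r j) _) (≤-reflexive (sym (serve-go j js ge))))
  ... | inj₂ r≤a
    with ws₁ , ws₂ , refl , A₁ , A₂ ← assign-block-split {a = r j}
           (subst (λ a → Assignment unitCost (replicate a i) (expand r (j ∷ js)) ws) (sym (m+[n∸m]≡n r≤a)) A)
    with fin , eq ← assign-block⁻ I {i} {j} {r j} {r j} {expand r js} A₁ ≤-refl = begin
    a                                                                       ≡⟨ m+[n∸m]≡n r≤a ⟨
    r j + (a ∸ r j)
      ≤⟨ +-monoʳ-≤ (r j) (serve-max js A₂ ws₂≤ (∸-monoˡ-≤ (r j) a≤U)) ⟩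
    r j + serve I i r js (U ∸ r j) (β ∸ price I (unitCost i j) (r j))
      ≡⟨ serve-go j js (affordable-max I (unitCost i j) fin (⊓-glb ≤-refl (≤-trans r≤a a≤U)) paid) ⟨
    serve I i r (j ∷ js) U β                                                ∎
    where
    open ≤-Reasoning
    both : price I (unitCost i j) (r j) + sum ws₂ ≤ β
    both = ≤-trans (≤-reflexive (trans (cong (_+ sum ws₂) (sym eq)) (sym (sum-++ ws₁ ws₂)))) le
    paid : price I (unitCost i j) (r j) ≤ β
    paid = m+n≤o⇒m≤o _ both
    ws₂≤ : sum ws₂ ≤ β ∸ price I (unitCost i j) (r j)
    ws₂≤ = m+n≤o⇒m≤o∸n _ (≤-trans (≤-reflexive (+-comm (sum ws₂) _)) both)

-- The clients from right to left and the blocks of their units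

sum-allFin : ∀ {n} (f : Fin n → ℕ) → sum (map f (allFin n)) ≡ ∑ℕ f
sum-allFin {zero}  f = refl
sum-allFin {suc n} f = cong (f zero +_) (begin
  sum (map f (tabulate suc))     ≡⟨ cong (sum ∘ map f) (map-tabulate id suc) ⟨
  sum (map f (map suc (allFin n)))              ≡⟨ cong sum (map-∘ (allFin n)) ⟨
  sum (map (f ∘ suc) (allFin n))                ≡⟨ sum-allFin (f ∘ suc) ⟩
  ∑ℕ (f ∘ suc)                                  ∎)
  where open ≡-Reasoning

downFrom : ∀ n → List (Fin n)
downFrom n = reverse (allFin n)

sum-downFrom : ∀ {n} (f : Fin n → ℕ) → sum (map f (downFrom n)) ≡ ∑ℕ f
sum-downFrom {n} f = trans (sum-↭ (map⁺ f (↭-reverse (allFin n)))) (sum-allFin f)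

downFrom-suc : ∀ n → downFrom (suc n) ≡ map suc (downFrom n) ++ zero ∷ []
downFrom-suc n = begin
  reverse (zero ∷ tabulate suc)       ≡⟨ unfold-reverse zero (tabulate suc) ⟩
  reverse (tabulate suc) ++ zero ∷ [] ≡⟨ cong (λ is → reverse is ++ zero ∷ []) (map-tabulate id suc) ⟨
  reverse (map suc (allFin n)) ++ zero ∷ []          ≡⟨ cong (_++ zero ∷ []) (reverse-map suc (allFin n)) ⟨
  map suc (downFrom n) ++ zero ∷ []                  ∎
  where open ≡-Reasoning

StrictlyDescending : ∀ {n} → List (Fin n) → Set
StrictlyDescending = AllPairs Fin._>_

downFrom-descending : ∀ n → StrictlyDescending (downFrom n)
downFrom-descending zero    = []
downFrom-descending (suc n) = subst StrictlyDescending (sym (downFrom-suc n))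
  (AllPairs.++⁺ (AllPairs.map⁺ (AllPairs.map s≤s (downFrom-descending n))) ([] ∷ [])
    (All.map⁺ (All.universal (λ _ → z<s ∷ []) (downFrom n))))

module _ {A : Set} (d : A → ℕ) where

  expand-All : ∀ {P : A → Set} {js} → All P js → All P (expand d js)
  expand-All []               = []
  expand-All {js = j ∷ _} (p ∷ ps) = All.++⁺ (All.replicate⁺ (d j) p) (expand-All ps)

  -- `p` gives the position at which the block of each element starts in `expand d js`, when
  -- positions are counted from `o`.
  data Offsets (p : A → ℕ) : ℕ → List A → Set where
    []  : ∀ {o} → Offsets p o []
    _∷_ : ∀ {o j js} → p j ≡ o → Offsets p (o + d j) js → Offsets p o (j ∷ js)

  offsets-snoc : ∀ {p o js k} → Offsets p o js → p k ≡ o + sum (map d js) → Offsets p o (js ++ k ∷ [])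
  offsets-snoc {o = o} [] e = trans e (+-identityʳ o) ∷ []
  offsets-snoc {o = o} {js = j ∷ _} (e′ ∷ O) e = e′ ∷ offsets-snoc O (trans e (sym (+-assoc o (d j) _)))

  -- A block starting at `p j` loses the part of the first `s` positions beyond its start; truncated
  -- subtraction covers blocks that are dropped, cut or untouched alike. With the demand to the
  -- right as `p`, the new block length is the formula of `remaining`.
  drop-expand : ∀ s {p o js} → Offsets p o js →
                drop (s ∸ o) (expand d js) ≡ expand (λ j → d j ∸ (s ∸ p j)) js
  drop-expand s {o = o} [] = drop-[] (s ∸ o)
  drop-expand s {p} {js = j ∷ js} (refl ∷ O) = trans (drop-replicate (s ∸ p j) (d j))
    (cong (replicate (d j ∸ (s ∸ p j)) j ++_)
      (trans (cong (λ s → drop s (expand d js)) (∸-+-assoc s (p j) (d j))) (drop-expand s O)))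

expand-descending : ∀ {n} (d : Fin n → ℕ) {js} → StrictlyDescending js → Descending (expand d js)
expand-descending d []       = []
expand-descending d {j ∷ js} (j> ∷ D) = AllPairs.++⁺ (constant (d j)) (expand-descending d D)
  (All.replicate⁺ (d j) (expand-All d (All.map <⇒≤ j>)))
  where
  constant : ∀ a → Descending (replicate a j)
  constant zero    = []
  constant (suc a) = All.replicate⁺ a ≤-refl ∷ constant a

rightOf : ∀ {n} → (Fin n → ℕ) → Fin n → ℕ
rightOf d j = ∑ℕ (λ k → if does (j <ᶠ? k) then d k else 0)

downFrom-offsets : ∀ {n} (d : Fin n → ℕ) → Offsets d (rightOf d) 0 (downFrom n)
downFrom-offsets {zero}  d = []
downFrom-offsets {suc n} d = subst (Offsets d (rightOf d) 0) (sym (downFrom-suc n))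
  (offsets-snoc d (shifted (downFrom-offsets (d ∘ suc))) (sym (begin
    sum (map d (map suc (downFrom n)))       ≡⟨ cong sum (map-∘ (downFrom n)) ⟨
    sum (map (d ∘ suc) (downFrom n))         ≡⟨ sum-downFrom (d ∘ suc) ⟩
    ∑ℕ (d ∘ suc)                             ∎)))
  where
  open ≡-Reasoning
  shifted : ∀ {o js} → Offsets (d ∘ suc) (rightOf (d ∘ suc)) o js → Offsets d (rightOf d) o (map suc js)
  shifted []      = []
  shifted (e ∷ O) = e ∷ shifted O

-- Opening costs, plans, and adding a facility to a plan

count-absent : ∀ {n} {P : Fin n → Set} {h is} → (P h → ⊥) → All P is → count h is ≡ 0
count-absent {P = P} {h} ¬Ph ps = count-none {h = h} (All.map (λ p h≡i → ¬Ph (subst P (sym h≡i) p)) ps)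

openings : ∀ {m} → (Fin m → ℕ) → Subset m → ℕ
openings f O = ∑ℕ (λ h → if does (h ∈? O) then f h else 0)

openings-close : ∀ {m} (f : Fin m → ℕ) {O i} → i ∈ O → openings f O ≡ f i + openings f (O [ i ]≔ outside)
openings-close f {inside ∷ O} {zero}  i∈O = refl
openings-close f {inside ∷ O} {suc i} (there i∈O) =
  trans (cong (f zero +_) (openings-close (f ∘ suc) i∈O)) (x∙yz≈y∙xz (f zero) (f (suc i)) _)
openings-close f {outside ∷ O} {suc i} (there i∈O) = openings-close (f ∘ suc) i∈O

openings-open : ∀ {m} (f : Fin m → ℕ) {O i} → i ∉ O → openings f (O [ i ]≔ inside) ≡ f i + openings f O
openings-open f {inside ∷ O}  {zero}  i∉O = ⊥-elim (i∉O here)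
openings-open f {outside ∷ O} {zero}  i∉O = refl
openings-open f {inside ∷ O} {suc i} i∉O =
  trans (cong (f zero +_) (openings-open (f ∘ suc) (i∉O ∘ there))) (x∙yz≈y∙xz (f zero) (f (suc i)) _)
openings-open f {outside ∷ O} {suc i} i∉O = openings-open (f ∘ suc) (i∉O ∘ there)

∈-update⁻ : ∀ {m} {O : Subset m} {h i s} → h ≢ i → h ∈ O [ i ]≔ s → h ∈ O
∈-update⁻ {O = O} {h} {i} {s} h≢i h∈ =
  lookup⇒[]= h O (trans (sym (lookup∘update′ h≢i O s)) ([]=⇒lookup h∈))

∉-close : ∀ {m} {O : Subset m} {i} → i ∉ O [ i ]≔ outside
∉-close {O = O} {i} i∈ with () ← trans (sym (lookup∘update i O outside)) ([]=⇒lookup i∈)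

-- A solution in whole units, listed from right to left.
record Plan {m n} (I : CFL m n) (i b t : ℕ) : Set where
  open CFL I
  field
    opened   : Subset m
    servers  : List (Fin m)
    payments : List ℕ
    from     : ∀ h → h ∈ opened → i ≤ toℕ h
    used     : All (_∈ opened) servers
    loads    : ∀ h → count h servers ≤ capacity h
    assigned : Assignment unitCost servers (expand demand (downFrom n)) payments
    total    : length servers ≡ t
    budget   : openings openingCost opened + sum payments ≤ b

module _ {m n} (I : CFL m n) where
  open CFL I
  open Plan

  clients : List (Fin n)
  clients = expand demand (downFrom n)

  drop-clients : ∀ s → drop s clients ≡ expand (remaining I s) (downFrom n)
  drop-clients s = drop-expand demand s (downFrom-offsets demand)

  DM-open : ∀ i s {β} → openingCost i ≤ β →
    DM I i s β ≡ serve I i (remaining I s) (downFrom n) (capacity i) (β ∸ openingCost i)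
  DM-open i s {β} le = cong (λ q → if q then served else 0) (dec-true (openingCost i ≤? β) le)
    where
    served : ℕ
    served = serve I i (remaining I s) (downFrom n) (capacity i) (β ∸ openingCost i)

  DM-closed : ∀ i s {β} → β < openingCost i → DM I i s β ≡ 0
  DM-closed i s {β} lt = cong (λ q → if q then served else 0) (dec-false (openingCost i ≤? β) (<⇒≱ lt))
    where
    served : ℕ
    served = serve I i (remaining I s) (downFrom n) (capacity i) (β ∸ openingCost i)

  DM-sound : ∀ i s {β} → openingCost i ≤ β → ∃[ ws ]
    Assignment unitCost (replicate (DM I i s β) i) (drop s clients) ws ×
    openingCost i + sum ws ≤ β × DM I i s β ≤ capacity i
  DM-sound i s {β} le rewrite DM-open i s le | drop-clients s
    with ws , A , paid , cap ← serve-sound I i (remaining I s) (downFrom n) (capacity i) (β ∸ openingCost i) =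
    ws , A , ≤-trans (+-monoʳ-≤ (openingCost i) paid) (≤-reflexive (m+[n∸m]≡n le)) , cap

  DM-max : ∀ i s {a β ws} → Assignment unitCost (replicate a i) (drop s clients) ws →
    openingCost i + sum ws ≤ β → a ≤ capacity i → a ≤ DM I i s β
  DM-max i s {a} {β} {ws} A paid cap = subst (a ≤_) (sym (DM-open i s (m+n≤o⇒m≤o _ paid)))
    (serve-max I i (remaining I s) (downFrom n)
      (subst (λ ks → Assignment unitCost (replicate a i) ks ws) (drop-clients s) A)
      (m+n≤o⇒m≤o∸n _ (≤-trans (≤-reflexive (+-comm (sum ws) _)) paid)) cap)

  -- The plan has served exactly the first `s` units, which is the state that `DM` starts from, so
  -- its run can be appended. Facility `i` was closed before, so it has its full capacity and its
  -- opening cost is charged once.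
  extend-plan : ∀ {i b′ b s} → b′ ≤ b → Plan I (suc (toℕ i)) b′ s →
                Plan I (toℕ i) b (s + DM I i s (b ∸ b′))
  extend-plan {i} {b′} {b} {s} b′≤b P with ≤-<-connex (openingCost i) (b ∸ b′)
  -- Too little budget to open `i`: `DM` is 0 and the old plan is kept.
  ... | inj₂ lt rewrite DM-closed i s lt | +-identityʳ s = record
    { opened = opened P; servers = servers P; payments = payments P
    ; from = λ h h∈ → <⇒≤ (from P h h∈)
    ; used = used P; loads = loads P; assigned = assigned P; total = total P
    ; budget = ≤-trans (budget P) b′≤b }
  ... | inj₁ le with ws , A , paid , cap ← DM-sound i s le = record
    { opened   = opened P [ i ]≔ inside
    ; servers  = servers P ++ replicate a i
    ; payments = payments P ++ ws
    ; from     = from′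
    ; used     = All.++⁺ (All.map keep (used P)) (All.replicate⁺ a ([]≔-updates (opened P) i))
    ; loads    = loads′ cap
    ; assigned = assign-++ (assigned P)
                   (subst (λ l → Assignment unitCost (replicate a i) (drop l clients) ws) (sym (total P)) A)
    ; total    = trans (length-++ (servers P)) (cong₂ _+_ (total P) (length-replicate a))
    ; budget   = begin
        openings openingCost (opened P [ i ]≔ inside) + sum (payments P ++ ws)
          ≡⟨ cong₂ _+_ (openings-open openingCost i∉) (sum-++ (payments P) ws) ⟩
        openingCost i + openings openingCost (opened P) + (sum (payments P) + sum ws)
          ≡⟨ regroup (openingCost i) (openings openingCost (opened P)) _ _ ⟩
        openings openingCost (opened P) + sum (payments P) + (openingCost i + sum ws)
          ≤⟨ +-mono-≤ (budget P) paid ⟩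
        b′ + (b ∸ b′)
          ≡⟨ m+[n∸m]≡n b′≤b ⟩
        b ∎
    }
    where
    open ≤-Reasoning
    a : ℕ
    a = DM I i s (b ∸ b′)

    i∉ : i ∉ opened P
    i∉ i∈ = <-irrefl refl (from P i i∈)

    keep : ∀ {h} → h ∈ opened P → h ∈ opened P [ i ]≔ inside
    keep {h} h∈ = []≔-minimal (opened P) h i (λ h≡i → i∉ (subst (_∈ opened P) h≡i h∈)) h∈

    from′ : ∀ h → h ∈ opened P [ i ]≔ inside → toℕ i ≤ toℕ h
    from′ h h∈ with h ≟ i
    ... | yes refl = ≤-refl
    ... | no h≢i   = <⇒≤ (from P h (∈-update⁻ h≢i h∈))

    loads′ : a ≤ capacity i → ∀ h → count h (servers P ++ replicate a i) ≤ capacity h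
    loads′ cap h rewrite count-++ h (servers P) (replicate a i) | count-replicate h i a with h ≟ i
    ... | yes refl rewrite count-absent i∉ (used P) = ≤-trans (≤-reflexive (*-identityʳ a)) cap
    ... | no h≢i rewrite *-zeroʳ a = ≤-trans (≤-reflexive (+-identityʳ _)) (loads P h)

    regroup : ∀ w x y z → w + x + (y + z) ≡ x + y + (w + z)
    regroup w x y z = trans (cong (_+ (y + z)) (+-comm w x)) (interchange x w y z)

-- Removing the lowest facility from a plan

split-last : ∀ {m} {i : Fin m} {is} → Descending is → All (i Fin.≤_) is →
             ∃₂ λ hs a → is ≡ hs ++ replicate a i × All (i <ᶠ_) hs
split-last [] [] = [] , 0 , refl , []
split-last {i = i} {h ∷ is} (h≥ ∷ D) (i≤h ∷ i≤) with i ≟ h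
... | yes refl = [] , suc (length is) , cong (i ∷_) (constant h≥ i≤) , []
  where
  constant : ∀ {is} → All (Fin._≤ i) is → All (i Fin.≤_) is → is ≡ replicate (length is) i
  constant []       []       = refl
  constant (p ∷ ps) (q ∷ qs) = cong₂ _∷_ (Fin.≤-antisym p q) (constant ps qs)
... | no i≢h with hs , a , refl , ps ← split-last D i≤ = h ∷ hs , a , refl , Fin.≤∧≢⇒< i≤h i≢h ∷ ps

-- Servers and clients lose their first `e` entries together, so each unit that `i` retains keeps
-- its client and its cost.
assign-drop : ∀ {m n} {c : Costs m n} e {a i ks ws} → Assignment c (replicate a i) ks ws →
  ∃[ ws′ ] Assignment c (replicate (a ∸ e) i) (drop e ks) ws′ × sum ws′ ≤ sum ws
assign-drop zero            A       = _ , A , ≤-refl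
assign-drop (suc e) {zero}  []      = [] , [] , z≤n
assign-drop (suc e) {suc a} (_∷_ {w = w} _ A) with ws′ , A′ , le ← assign-drop e A =
  ws′ , A′ , ≤-trans le (m≤n+m _ w)

module _ {m n} (I : CFL m n) (monge : Monge I) where
  open CFL I
  open Plan

  clients-descending : Descending (clients I)
  clients-descending = expand-descending demand (downFrom-descending n)

  -- The last clause ranges over all `s*` from `s` on because the recursion evaluates `DM` at the
  -- best amount for budget `b′`, which may exceed the amount `s` served by the restricted plan.
  restrict-plan : ∀ {i b t} → Plan I (toℕ i) b t → ∃₂ λ b′ s → b′ ≤ b ×
                  Plan I (suc (toℕ i)) b′ s × (∀ s* → s ≤ s* → t ≤ s* + DM I i s* (b ∸ b′))
  restrict-plan {i} {b} {t} P
    with is , ws , perm , D , A , le ← sort-≤ monge clients-descending (assigned P)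
    with used′ ← All-resp-↭ (↭-sym perm) (used P)
    with hs , a , refl , i<hs ← split-last D (All.map (λ {h} → from P h) used′)
    with ws₁ , ws₂ , refl , A₁ , A₂ ← assign-split hs A =
    restricted (i ∈? opened P)
    where
    open ≤-Reasoning

    loads₁ : ∀ h → count h hs + a * δ h i ≤ capacity h
    loads₁ h = begin
      count h hs + a * δ h i                    ≡⟨ cong (count h hs +_) (count-replicate h i a) ⟨
      count h hs + count h (replicate a i)      ≡⟨ count-++ h hs (replicate a i) ⟨
      count h (hs ++ replicate a i)             ≡⟨ sum-↭ (map⁺ (δ h) perm) ⟩
      count h (servers P)                       ≤⟨ loads P h ⟩
      capacity h                                ∎

    total₁ : length hs + a ≡ t
    total₁ = begin-equality
      length hs + a                             ≡⟨ cong (length hs +_) (length-replicate a) ⟨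
      length hs + length (replicate a i)        ≡⟨ length-++ hs ⟨
      length (hs ++ replicate a i)              ≡⟨ ↭-length perm ⟩
      length (servers P)                        ≡⟨ total P ⟩
      t                                         ∎

    budget₁ : openings openingCost (opened P) + (sum ws₁ + sum ws₂) ≤ b
    budget₁ = begin
      openings openingCost (opened P) + (sum ws₁ + sum ws₂)
        ≡⟨ cong (openings openingCost (opened P) +_) (sum-++ ws₁ ws₂) ⟨
      openings openingCost (opened P) + sum (ws₁ ++ ws₂)       ≤⟨ +-monoʳ-≤ (openings openingCost (opened P)) le ⟩
      openings openingCost (opened P) + sum (payments P)       ≤⟨ budget P ⟩
      b                                                        ∎

    used₁ : All (λ h → h ∈ opened P × i <ᶠ h) hs
    used₁ = All.zip (All.++⁻ˡ hs used′ , i<hs)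

    restricted : Dec (i ∈ opened P) → ∃₂ λ b′ s → b′ ≤ b ×
                 Plan I (suc (toℕ i)) b′ s × (∀ s* → s ≤ s* → t ≤ s* + DM I i s* (b ∸ b′))
    -- If `i` is closed, its run at the end of the sorted list is empty, so the later facilities
    -- already serve all `t` units.
    restricted (no i∉) = openings openingCost (opened P) + sum ws₁ , length hs , cheaper , record
      { opened   = opened P
      ; servers  = hs
      ; payments = ws₁
      ; from     = λ h h∈ → Fin.≤∧≢⇒< (from P h h∈) (λ i≡h → i∉ (subst (_∈ opened P) (sym i≡h) h∈))
      ; used     = All.map proj₁ used₁
      ; loads    = λ h → m+n≤o⇒m≤o _ (loads₁ h)
      ; assigned = A₁
      ; total    = refl
      ; budget   = ≤-refl
      } , λ s* s≤s* → ≤-trans (≤-reflexive idle) (≤-trans s≤s* (m≤m+n s* _))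
      where
      cheaper : openings openingCost (opened P) + sum ws₁ ≤ b
      cheaper = ≤-trans (+-monoʳ-≤ (openings openingCost (opened P)) (m≤m+n (sum ws₁) (sum ws₂))) budget₁

      unused : ∀ a → All (_∈ opened P) (replicate a i) → a ≡ 0
      unused zero    _        = refl
      unused (suc a) (i∈ ∷ _) = ⊥-elim (i∉ i∈)

      idle : t ≡ length hs
      idle = trans (sym total₁) (trans (cong (length hs +_) (unused a (All.++⁻ʳ hs used′))) (+-identityʳ _))
    restricted (yes i∈) = b′ , length hs , m+n≤o⇒m≤o b′ split , record
      { opened   = opened P [ i ]≔ outside
      ; servers  = hs
      ; payments = ws₁
      ; from     = from′
      ; used     = All.map (λ {h} (h∈ , i<h) → []≔-minimal (opened P) h i (Fin.<⇒≢ i<h ∘ sym) h∈) used₁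
      ; loads    = λ h → m+n≤o⇒m≤o _ (loads₁ h)
      ; assigned = A₁
      ; total    = refl
      ; budget   = ≤-refl
      } , continue
      where
      -- Exactly what the later facilities spend in the sorted list. It is a natural number, and
      -- what remains of `b` covers the opening cost and the payments of `i`.
      b′ : ℕ
      b′ = openings openingCost (opened P [ i ]≔ outside) + sum ws₁

      split : b′ + (openingCost i + sum ws₂) ≤ b
      split = begin
        b′ + (openingCost i + sum ws₂)
          ≡⟨ regroup (openings openingCost (opened P [ i ]≔ outside)) (sum ws₁) (openingCost i) (sum ws₂) ⟩
        openingCost i + openings openingCost (opened P [ i ]≔ outside) + (sum ws₁ + sum ws₂)
          ≡⟨ cong (_+ (sum ws₁ + sum ws₂)) (openings-close openingCost i∈) ⟨
        openings openingCost (opened P) + (sum ws₁ + sum ws₂)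
          ≤⟨ budget₁ ⟩
        b ∎
        where
        regroup : ∀ w x y z → w + x + (y + z) ≡ y + w + (x + z)
        regroup w x y z = trans (interchange w x y z) (cong (_+ (x + z)) (+-comm w y))

      from′ : ∀ h → h ∈ opened P [ i ]≔ outside → toℕ i < toℕ h
      from′ h h∈ with h ≟ i
      ... | yes refl = ⊥-elim (∉-close {O = opened P} h∈)
      ... | no h≢i   = Fin.≤∧≢⇒< (from P h (∈-update⁻ h≢i h∈)) (h≢i ∘ sym)

      load : a ≤ capacity i
      load = begin
        a                         ≡⟨ *-identityʳ a ⟨
        a * 1                     ≡⟨ cong (a *_) (δ-refl i) ⟨
        a * δ i i                 ≤⟨ m≤n+m _ (count i hs) ⟩
        count i hs + a * δ i i    ≤⟨ loads₁ i ⟩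
        capacity i                ∎

      continue : ∀ s* → length hs ≤ s* → t ≤ s* + DM I i s* (b ∸ b′)
      continue s* s≤s* with ws₂′ , A₂′ , le′ ← assign-drop (s* ∸ length hs) A₂ = begin
        t                                      ≡⟨ total₁ ⟨
        length hs + a                          ≤⟨ +-monoʳ-≤ (length hs) (m≤n+m∸n a e) ⟩
        length hs + (e + (a ∸ e))              ≡⟨ +-assoc (length hs) e _ ⟨
        length hs + e + (a ∸ e)                ≡⟨ cong (_+ (a ∸ e)) (m+[n∸m]≡n s≤s*) ⟩
        s* + (a ∸ e)                           ≤⟨ +-monoʳ-≤ s* (DM-max I i s* moved paid (≤-trans (m∸n≤m a e) load)) ⟩
        s* + DM I i s* (b ∸ b′)                ∎
        where
        -- The surplus of the later facilities takes over the first `e` units of the run of `i`. If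
        -- `e` exceeds `a`, nothing is left for `i`, and the surplus alone makes up for its run.
        e : ℕ
        e = s* ∸ length hs

        moved : Assignment unitCost (replicate (a ∸ e) i) (drop s* (clients I)) ws₂′
        moved = subst (λ ks → Assignment unitCost (replicate (a ∸ e) i) ks ws₂′)
          (trans (drop-drop (length hs) e (clients I)) (cong (λ s → drop s (clients I)) (m+[n∸m]≡n s≤s*))) A₂′

        paid : openingCost i + sum ws₂′ ≤ b ∸ b′
        paid = begin
          openingCost i + sum ws₂′     ≤⟨ +-monoʳ-≤ (openingCost i) le′ ⟩
          openingCost i + sum ws₂      ≤⟨ m+n≤o⇒m≤o∸n _ (≤-trans (≤-reflexive (+-comm _ b′)) split) ⟩
          b ∸ b′                       ∎

-- Maxima and the recursion for plans

maximum-cong : ∀ {P Q : ℕ → Set} {v} → (∀ {t} → P t → Q t) → (∀ {t} → Q t → P t) →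
               IsMaximum P v → IsMaximum Q v
maximum-cong P⇒Q Q⇒P (Pv , max) = P⇒Q Pv , λ w Qw → max w (Q⇒P Qw)

maximum-unique : ∀ {P : ℕ → Set} {v w} → IsMaximum P v → IsMaximum P w → v ≡ w
maximum-unique (Pv , maxv) (Pw , maxw) = ≤-antisym (maxw _ Pv) (maxv _ Pw)

module _ {m n} (I : CFL m n) where
  open CFL I
  open Plan

  empty-plan : ∀ i b → Plan I i b 0
  empty-plan i b = record
    { opened = ∅ ; servers = [] ; payments = []
    ; from = λ h h∈ → ⊥-elim (∉⊥ h∈) ; used = [] ; loads = λ _ → z≤n
    ; assigned = [] ; total = refl
    ; budget = ≤-trans (≤-reflexive (trans (+-identityʳ _) (openings-∅ openingCost))) z≤n }
    where
    openings-∅ : ∀ {m} (f : Fin m → ℕ) → openings f ∅ ≡ 0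
    openings-∅ {zero}  f = refl
    openings-∅ {suc m} f = openings-∅ (f ∘ suc)

  last-plan : ∀ b → IsMaximum (Plan I m b) 0
  last-plan b = empty-plan m b , λ t P → nothing P (used P) (total P)
    where
    nothing : ∀ {t is} (P : Plan I m b t) → All (_∈ opened P) is → length is ≡ t → t ≤ 0
    nothing P []           refl = z≤n
    nothing P (_∷_ {h} h∈ _) _  = ⊥-elim (<⇒≱ (Fin.toℕ<n h) (from P h h∈))

  recursion : Monge I → ∀ {v : ℕ → ℕ} i b →
    (∀ b′ → IsMaximum (Plan I (suc (toℕ i)) b′) (v b′)) →
    IsMaximum (Plan I (toℕ i) b)
      (max 0 (map (λ b′ → v b′ + DM I i (v b′) (b ∸ b′)) (upTo (suc b))))
  recursion monge {v} i b v-max = attained , bound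
    where
    option : ℕ → ℕ
    option b′ = v b′ + DM I i (v b′) (b ∸ b′)

    attained : Plan I (toℕ i) b (max 0 (map option (upTo (suc b))))
    attained with argmax-sel id 0 (map option (upTo (suc b)))
    -- The default value 0 of `max` is attained as well, by serving nothing.
    ... | inj₁ e = subst (Plan I (toℕ i) b) (sym e) (empty-plan (toℕ i) b)
    ... | inj₂ ∈ with b′ , b′∈ , e ← ∈-map⁻ option ∈ =
      subst (Plan I (toℕ i) b) (sym e) (extend-plan I (s≤s⁻¹ (∈-upTo⁻ b′∈)) (proj₁ (v-max b′)))

    bound : ∀ t → Plan I (toℕ i) b t → t ≤ max 0 (map option (upTo (suc b)))
    bound t P with b′ , s , b′≤b , P′ , continue ← restrict-plan I monge P =
      ≤-trans (continue (v b′) (proj₂ (v-max b′) s P′))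
        (v≤max⁺ 0 _ (inj₂ (Any.map ≤-reflexive (∈-map⁺ option (∈-upTo⁺ (s≤s b′≤b))))))

-- Rounding fractional flows to plans

δ-sym : ∀ {n} (h i : Fin n) → δ h i ≡ δ i h
δ-sym h i with h ≟ i
... | yes refl = sym (δ-refl h)
... | no h≢i   = sym (δ-≢ (h≢i ∘ sym))

∑-δ : ∀ {n} (h : Fin n) (f : Fin n → ℕ) → ∑ℕ (λ i → δ i h * f i) ≡ f h
∑-δ {suc n} zero f = trans (cong₂ _+_ (*-identityˡ (f zero)) (sum-replicate-zero n)) (+-identityʳ _)
∑-δ (suc h) f = ∑-δ h (f ∘ suc)

count-expand : ∀ {n} (h : Fin n) d is → count h (expand d is) ≡ sum (map (λ i → δ i h * d i) is)
count-expand h d []       = refl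
count-expand h d (i ∷ is) = begin
  count h (replicate (d i) i ++ expand d is)                     ≡⟨ count-++ h (replicate (d i) i) (expand d is) ⟩
  count h (replicate (d i) i) + count h (expand d is)
    ≡⟨ cong₂ _+_ (count-replicate h i (d i)) (count-expand h d is) ⟩
  d i * δ h i + sum (map (λ i → δ i h * d i) is)
    ≡⟨ cong (_+ sum (map (λ i → δ i h * d i) is)) (trans (*-comm (d i) (δ h i)) (cong (_* d i) (δ-sym h i))) ⟩
  δ i h * d i + sum (map (λ i → δ i h * d i) is)                 ∎
  where open ≡-Reasoning

count-concatMap : ∀ {n} {A : Set} (h : Fin n) (f : A → List (Fin n)) js →
                  count h (concatMap f js) ≡ sum (map (count h ∘ f) js)
count-concatMap h f []       = refl
count-concatMap h f (j ∷ js) = trans (count-++ h (f j) _) (cong (count h (f j) +_) (count-concatMap h f js))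

length-expand : ∀ {A : Set} (d : A → ℕ) is → length (expand d is) ≡ sum (map d is)
length-expand d []       = refl
length-expand d (i ∷ is) =
  trans (length-++ (replicate (d i) i)) (cong₂ _+_ (length-replicate (d i)) (length-expand d is))

length-concatMap : ∀ {A B : Set} (f : A → List B) js → length (concatMap f js) ≡ sum (map (length ∘ f) js)
length-concatMap f []       = refl
length-concatMap f (j ∷ js) = trans (length-++ (f j)) (cong (length (f j) +_) (length-concatMap f js))

-- The order of the facilities within a client is immaterial, as the whole list is sorted before it
-- is sampled.
flowColumn : ∀ {m n} → (Fin m → Fin n → ℕ) → Fin n → List (Fin m)
flowColumn {m} y j = expand (λ i → y i j) (allFin m)

flowServers : ∀ {m n} → (Fin m → Fin n → ℕ) → List (Fin m)
flowServers {n = n} y = concatMap (flowColumn y) (downFrom n)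

-- A solution with y i j measured in N-th parts of a unit.
record Flow {m n} (I : CFL m n) (N b t : ℕ) (O : Subset m) (y : Fin m → Fin n → ℕ) : Set where
  open CFL I
  field
    used    : ∀ i j → 0 < y i j → i ∈ O
    finite  : ∀ i j → 0 < y i j → ∃[ w ] unitCost i j ≡ [ w ]
    covered : ∀ j → ∑ℕ (λ i → y i j) ≤ N * demand j
    loads   : ∀ i → ∑ℕ (y i) ≤ N * capacity i
    prefix  : ∀ {j k} → j <ᶠ k → 0 < ∑ℕ (λ i → y i j) → ∑ℕ (λ i → y i k) ≡ N * demand k
    total   : ∑ℕ (λ j → ∑ℕ (λ i → y i j)) ≡ N * t
    budget  : N * openings openingCost O + ∑ℕ (λ i → ∑ℕ (λ j → price I (unitCost i j) (y i j))) ≤ N * b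

module _ {m n} (I : CFL m n) {N b t : ℕ} {O : Subset m} {y : Fin m → Fin n → ℕ} (F : Flow I N b t O y) where
  open CFL I
  open Flow F

  private
    column : Fin n → List (Fin m)
    column = flowColumn y

    cost : Fin m → Fin n → ℕ
    cost i j = price I (unitCost i j) (y i j)

  length-column : ∀ j → length (column j) ≡ ∑ℕ (λ i → y i j)
  length-column j = trans (length-expand (λ i → y i j) (allFin m)) (sum-allFin (λ i → y i j))

  assign-column : ∀ is {j B ks} → sum (map (λ i → y i j) is) ≤ B → ∃[ ws ]
    Assignment unitCost (expand (λ i → y i j) is) (replicate B j ++ ks) ws ×
    sum ws ≡ sum (map (λ i → cost i j) is)
  assign-column []       _ = [] , [] , refl
  assign-column (i ∷ is) {j} {B} {ks} le
    with ws , A , eq ← assign-block I {i} {j} {y i j} {B} {ks} (finite i j) (m+n≤o⇒m≤o _ le)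
    with ws′ , A′ , eq′ ← assign-column is {j} {B ∸ y i j} {drop (y i j ∸ B) ks}
                            (m+n≤o⇒m≤o∸n _ (≤-trans (≤-reflexive (+-comm _ (y i j))) le)) =
    ws ++ ws′ ,
    assign-++ A (subst (λ ks → Assignment unitCost (expand (λ i → y i j) is) ks ws′) (sym rest) A′) ,
    trans (sum-++ ws ws′) (cong₂ _+_ eq eq′)
    where
    rest : drop (length (replicate (y i j) i)) (replicate B j ++ ks) ≡ replicate (B ∸ y i j) j ++ drop (y i j ∸ B) ks
    rest = trans (cong (λ a → drop a (replicate B j ++ ks)) (length-replicate (y i j))) (drop-replicate (y i j) B)

  -- A client that is not fully served is the last one in the order of service.
  assign-columns : ∀ js → StrictlyDescending js → ∃[ ws ]
    Assignment unitCost (concatMap column js) (expand (λ j → N * demand j) js) ws ×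
    sum ws ≡ sum (map (λ j → ∑ℕ (λ i → cost i j)) js)
  assign-columns []       _        = [] , [] , refl
  assign-columns (j ∷ js) (j> ∷ D)
    with ws , A , eq ← assign-column (allFin m) {j} {N * demand j} {expand (λ j → N * demand j) js}
                         (≤-trans (≤-reflexive (sum-allFin (λ i → y i j))) (covered j))
    with ws′ , A′ , eq′ ← assign-columns js D =
    ws ++ ws′ , assign-++ A (rest (m≤n⇒m<n∨m≡n (covered j))) ,
    trans (sum-++ ws ws′) (cong₂ _+_ (trans eq (sum-allFin (λ i → cost i j))) eq′)
    where
    ks : List (Fin n)
    ks = expand (λ j → N * demand j) js

    unserved : ∑ℕ (λ i → y i j) < N * demand j → ∀ {js} → All (Fin._< j) js → concatMap column js ≡ []
    unserved lt [] = refl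
    unserved lt (_∷_ {k} k<j ks<j) with ∑ℕ (λ i → y i k) in eq
    ... | suc _ = ⊥-elim (<-irrefl (prefix k<j (≤-trans z<s (≤-reflexive (sym eq)))) lt)
    ... | zero with column k | trans (length-column k) eq
    ...   | [] | _ = unserved lt ks<j

    rest : ∑ℕ (λ i → y i j) < N * demand j ⊎ ∑ℕ (λ i → y i j) ≡ N * demand j →
           Assignment unitCost (concatMap column js) (drop (length (column j)) (replicate (N * demand j) j ++ ks)) ws′
    rest (inj₂ full) = subst (λ ks → Assignment unitCost (concatMap column js) ks ws′) (sym (begin
      drop (length (column j)) (replicate (N * demand j) j ++ ks)
        ≡⟨ cong (λ a → drop a (replicate (N * demand j) j ++ ks)) (trans (length-column j) full) ⟩
      drop (N * demand j) (replicate (N * demand j) j ++ ks)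
        ≡⟨ drop-replicate (N * demand j) (N * demand j) ⟩
      replicate (N * demand j ∸ N * demand j) j ++ drop (N * demand j ∸ N * demand j) ks
        ≡⟨ cong (λ a → replicate a j ++ drop a ks) (n∸n≡0 (N * demand j)) ⟩
      ks                                                                                ∎)) A′
      where open ≡-Reasoning
    -- No server is left after an incomplete client, and the empty assignment fits any list of
    -- clients, even one that still begins with units of `j`.
    rest (inj₁ lt) = empty (unserved lt j>) A′
      where
      empty : ∀ {is ks ks′ ws} → is ≡ [] → Assignment unitCost is ks ws → Assignment unitCost is ks′ ws
      empty refl [] = []

  servers-length : length (flowServers y) ≡ N * t
  servers-length = begin
    length (flowServers y)            ≡⟨ length-concatMap column (downFrom n) ⟩
    sum (map (length ∘ column) (downFrom n))          ≡⟨ sum-downFrom (length ∘ column) ⟩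
    ∑ℕ (length ∘ column)                              ≡⟨ sum-cong-≗ length-column ⟩
    ∑ℕ (λ j → ∑ℕ (λ i → y i j))                       ≡⟨ total ⟩
    N * t                                             ∎
    where open ≡-Reasoning

  servers-loads : ∀ h → count h (flowServers y) ≤ N * capacity h
  servers-loads h = ≤-trans (≤-reflexive (begin
    count h (flowServers y)            ≡⟨ count-concatMap h column (downFrom n) ⟩
    sum (map (count h ∘ column) (downFrom n))          ≡⟨ sum-downFrom (count h ∘ column) ⟩
    ∑ℕ (count h ∘ column)
      ≡⟨ sum-cong-≗ (λ j → trans (count-expand h (λ i → y i j) (allFin m))
                                                            (trans (sum-allFin (λ i → δ i h * y i j)) (∑-δ h (λ i → y i j)))) ⟩
    ∑ℕ (y h)                                           ∎)) (loads h)
    where open ≡-Reasoning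

  servers-used : All (_∈ O) (flowServers y)
  servers-used = columns (downFrom n)
    where
    blocks : ∀ j is → All (_∈ O) (expand (λ i → y i j) is)
    blocks j []       = []
    blocks j (i ∷ is) with y i j in eq
    ... | zero  = blocks j is
    ... | suc a = All.++⁺ (All.replicate⁺ (suc a) (used i j (≤-trans z<s (≤-reflexive (sym eq))))) (blocks j is)
    columns : ∀ js → All (_∈ O) (concatMap column js)
    columns []       = []
    columns (j ∷ js) = All.++⁺ (blocks j (allFin m)) (columns js)

flow⇒plan : ∀ {m n} (I : CFL m n) → Monge I → ∀ {M i b t O y} → Flow I (suc M) b t O y →
            (∀ h → h ∈ O → i ≤ toℕ h) → Plan I i b t
flow⇒plan {m} {n} I monge {M} {i} {b} {t} {O} {y} F from
  with ws₀ , A₀ , eq₀ ← assign-columns I F (downFrom n) (downFrom-descending n)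
  with is , ws , perm , D , A , le ← sort-≤ monge
         (expand-descending (λ j → suc M * CFL.demand I j) (downFrom-descending n)) A₀
  with r , r≤M , cheap ← cheap-sample M M ws = record
  { opened   = O
  ; servers  = sample M r is
  ; payments = sample M r ws
  ; from     = from
  ; used     = sample-All M r (All-resp-↭ (↭-sym perm) (servers-used I F))
  ; loads    = loads′
  ; assigned = subst (λ ks → Assignment unitCost (sample M r is) ks (sample M r ws))
                 (sample-expand M demand (downFrom n) r≤M) (assign-sample M r A)
  ; total    = length-sample M t {is} r≤M (trans (↭-length perm) (servers-length I F))
  ; budget   = *-cancelˡ-≤ (suc M) budget′
  }
  where
  open CFL I
  open Flow F
  open ≤-Reasoning

  -- The sampling bound exceeds `suc M * capacity h` by at most `M`, which is less than one further
  -- multiple of `suc M`; hence no rounding loss remains after division.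
  loads′ : ∀ h → count h (sample M r is) ≤ capacity h
  loads′ h = s≤s⁻¹ (*-cancelˡ-< (suc M) _ _ (begin-strict
    suc M * count h (sample M r is)                    ≤⟨ count-sample M r h r≤M D ⟩
    count h is + M                                     ≡⟨ cong (_+ M) (sum-↭ (map⁺ (δ h) perm)) ⟩
    count h (flowServers y) + M                                      ≤⟨ +-monoˡ-≤ M (servers-loads I F h) ⟩
    suc M * capacity h + M                             <⟨ +-monoʳ-< (suc M * capacity h) (n<1+n M) ⟩
    suc M * capacity h + suc M                         ≡⟨ +-comm _ (suc M) ⟩
    suc M + suc M * capacity h                         ≡⟨ *-suc (suc M) (capacity h) ⟨
    suc M * suc (capacity h)                           ∎))

  budget′ : suc M * (openings openingCost O + sum (sample M r ws)) ≤ suc M * b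
  budget′ = begin
    suc M * (openings openingCost O + sum (sample M r ws))
      ≡⟨ *-distribˡ-+ (suc M) (openings openingCost O) _ ⟩
    suc M * openings openingCost O + suc M * sum (sample M r ws)
      ≤⟨ +-monoʳ-≤ (suc M * openings openingCost O) (begin
      suc M * sum (sample M r ws)                                         ≤⟨ cheap ⟩
      samples-sum M M ws                                                  ≡⟨ samples-sum-all M ws ⟩
      sum ws                                                              ≤⟨ le ⟩
      sum ws₀                                                             ≡⟨ eq₀ ⟩
      sum (map (λ j → ∑ℕ (λ i → price I (unitCost i j) (y i j))) (downFrom n))
                                                                          ≡⟨ sum-downFrom (λ j → ∑ℕ (λ i → price I (unitCost i j) (y i j))) ⟩
      ∑ℕ (λ j → ∑ℕ (λ i → price I (unitCost i j) (y i j)))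
        ≡⟨ ∑-comm (λ j i → price I (unitCost i j) (y i j)) ⟩
      ∑ℕ (λ i → ∑ℕ (λ j → price I (unitCost i j) (y i j)))                ∎) ⟩
    suc M * openings openingCost O + ∑ℕ (λ i → ∑ℕ (λ j → price I (unitCost i j) (y i j)))
                                                                        ≤⟨ budget ⟩
    suc M * b                                                           ∎

-- Plans as flows with denominator 1

price-0 : ∀ {m n} (I : CFL m n) c → price I c 0 ≡ 0
price-0 I ⊤⁺    = refl
price-0 I [ c ] = *-zeroʳ c

price-+ : ∀ {m n} (I : CFL m n) c a b → price I c (a + b) ≡ price I c a + price I c b
price-+ I ⊤⁺    a b = refl
price-+ I [ c ] a b = *-distribˡ-+ c a b

price-* : ∀ {m n} (I : CFL m n) c a b → price I c (a * b) ≡ a * price I c b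
price-* I ⊤⁺    a b = sym (*-zeroʳ a)
price-* I [ c ] a b = x*yz≡y*xz c a b

-- The number of positions at which `i` serves `j`. Writing it as a sum of products of indicators
-- reduces row sums, column sums and prices to `∑-δ`.
flow : ∀ {m n} → List (Fin m) → List (Fin n) → Fin m → Fin n → ℕ
flow (h ∷ is) (k ∷ ks) i j = δ i h * δ j k + flow is ks i j
flow _        _        i j = 0

flow-used : ∀ {m n} {P : Fin m → Set} {is} → All P is → ∀ (ks : List (Fin n)) {i j} →
            0 < flow is ks i j → P i
flow-used {is = h ∷ _} (p ∷ ps) (k ∷ ks) {i} lt with i ≟ h
... | yes refl = p
... | no _     = flow-used ps ks lt

flow-finite : ∀ {m n} {c : Costs m n} {is ks ws} → Assignment c is ks ws →
              ∀ {i j} → 0 < flow is ks i j → ∃[ w ] c i j ≡ [ w ]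
flow-finite (_∷_ {h} {k} e A) {i} {j} lt with i ≟ h | j ≟ k
... | yes refl | yes refl = _ , e
... | yes _    | no _     = flow-finite A lt
... | no _     | yes _    = flow-finite A lt
... | no _     | no _     = flow-finite A lt

flow-row : ∀ {m n} {c : Costs m n} {is ks ws} → Assignment c is ks ws →
           ∀ i → ∑ℕ (flow is ks i) ≡ count i is
flow-row {n = n} [] i = sum-replicate-zero n
flow-row {n = n} (_∷_ {h} {k} {is = is} {ks} e A) i = begin
  ∑ℕ (λ j → δ i h * δ j k + flow is ks i j)                 ≡⟨ ∑-distrib-+ (λ j → δ i h * δ j k) (flow is ks i) ⟩
  ∑ℕ (λ j → δ i h * δ j k) + ∑ℕ (flow is ks i)
    ≡⟨ cong₂ _+_ (trans (sum-cong-≗ (λ j → *-comm (δ i h) (δ j k))) (∑-δ k (λ _ → δ i h))) (flow-row A i) ⟩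
  δ i h + count i is                                        ∎
  where open ≡-Reasoning

flow-column : ∀ {m n} {c : Costs m n} {is ks ws} → Assignment c is ks ws →
              ∀ j → ∑ℕ (λ i → flow is ks i j) ≡ count j (take (length is) ks)
flow-column {m} [] j = sum-replicate-zero m
flow-column (_∷_ {h} {k} {is = is} {ks} e A) j = begin
  ∑ℕ (λ i → δ i h * δ j k + flow is ks i j)
    ≡⟨ ∑-distrib-+ (λ i → δ i h * δ j k) (λ i → flow is ks i j) ⟩
  ∑ℕ (λ i → δ i h * δ j k) + ∑ℕ (λ i → flow is ks i j)
    ≡⟨ cong₂ _+_ (∑-δ h (λ _ → δ j k)) (flow-column A j) ⟩
  δ j k + count j (take (length is) ks)                                ∎
  where open ≡-Reasoning

count-total : ∀ {n} (is : List (Fin n)) → ∑ℕ (λ i → count i is) ≡ length is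
count-total {n} []       = sum-replicate-zero n
count-total {n} (h ∷ is) = begin
  ∑ℕ (λ i → δ i h + count i is)              ≡⟨ ∑-distrib-+ (λ i → δ i h) (λ i → count i is) ⟩
  ∑ℕ (λ i → δ i h) + ∑ℕ (λ i → count i is)
    ≡⟨ cong₂ _+_ (trans (sum-cong-≗ (λ i → sym (*-identityʳ (δ i h)))) (∑-δ h (λ _ → 1))) (count-total is) ⟩
  suc (length is)                            ∎
  where open ≡-Reasoning

flow-total : ∀ {m n} {c : Costs m n} {is ks ws} → Assignment c is ks ws →
             ∑ℕ (λ j → ∑ℕ (λ i → flow is ks i j)) ≡ length is
flow-total {is = is} {ks} A = begin
  ∑ℕ (λ j → ∑ℕ (λ i → flow is ks i j))   ≡⟨ ∑-comm (λ j i → flow is ks i j) ⟩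
  ∑ℕ (λ i → ∑ℕ (flow is ks i))           ≡⟨ sum-cong-≗ (flow-row A) ⟩
  ∑ℕ (λ i → count i is)                  ≡⟨ count-total is ⟩
  length is                              ∎
  where open ≡-Reasoning

-- `price` is linear in the amount even at `⊤⁺`, where it is constantly 0. The indicators can
-- therefore be pulled out, and the double sum collapses to the price of one unit for each position.
flow-price : ∀ {m n} (I : CFL m n) {is ks ws} → Assignment (CFL.unitCost I) is ks ws →
             ∑ℕ (λ i → ∑ℕ (λ j → price I (CFL.unitCost I i j) (flow is ks i j))) ≡ sum ws
flow-price {m} {n} I [] = begin
  ∑ℕ (λ i → ∑ℕ (λ j → price I (CFL.unitCost I i j) 0))
    ≡⟨ sum-cong-≗ (λ i → trans (sum-cong-≗ (λ j → price-0 I (CFL.unitCost I i j))) (sum-replicate-zero n)) ⟩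
  ∑ℕ {m} (λ i → 0)                                       ≡⟨ sum-replicate-zero m ⟩
  0                                                      ∎
  where open ≡-Reasoning
flow-price {m} {n} I (_∷_ {h} {k} {w} {is} {ks} {ws} e A) = begin
  ∑ℕ (λ i → ∑ℕ (λ j → price I (unitCost i j) (δ i h * δ j k + flow is ks i j)))
    ≡⟨ sum-cong-≗ (λ i → trans (sum-cong-≗ (λ j → trans (price-+ I (unitCost i j) (δ i h * δ j k) (flow is ks i j))
         (cong (_+ price I (unitCost i j) (flow is ks i j)) (unit i j))))
         (∑-distrib-+ (λ j → δ j k * (δ i h * price I (unitCost i j) 1)) (λ j → price I (unitCost i j) (flow is ks i j)))) ⟩
  ∑ℕ (λ i → ∑ℕ (λ j → δ j k * (δ i h * price I (unitCost i j) 1)) + ∑ℕ (λ j → price I (unitCost i j) (flow is ks i j)))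
    ≡⟨ ∑-distrib-+ (λ i → ∑ℕ (λ j → δ j k * (δ i h * price I (unitCost i j) 1))) (λ i → ∑ℕ (λ j → price I (unitCost i j) (flow is ks i j))) ⟩
  ∑ℕ (λ i → ∑ℕ (λ j → δ j k * (δ i h * price I (unitCost i j) 1))) + ∑ℕ (λ i → ∑ℕ (λ j → price I (unitCost i j) (flow is ks i j)))
    ≡⟨ cong₂ _+_ (trans (sum-cong-≗ (λ i → ∑-δ k (λ j → δ i h * price I (unitCost i j) 1))) (∑-δ h (λ i → price I (unitCost i k) 1))) (flow-price I A) ⟩
  price I (unitCost h k) 1 + sum ws
    ≡⟨ cong (λ c → price I c 1 + sum ws) e ⟩
  w * 1 + sum ws
    ≡⟨ cong (_+ sum ws) (*-identityʳ w) ⟩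
  w + sum ws ∎
  where
  open ≡-Reasoning
  open CFL I
  unit : ∀ i j → price I (unitCost i j) (δ i h * δ j k) ≡ δ j k * (δ i h * price I (unitCost i j) 1)
  unit i j = begin
    price I (unitCost i j) (δ i h * δ j k)
      ≡⟨ cong (price I (unitCost i j)) (trans (*-comm (δ i h) (δ j k)) (cong (δ j k *_) (sym (*-identityʳ (δ i h))))) ⟩
    price I (unitCost i j) (δ j k * (δ i h * 1))      ≡⟨ price-* I (unitCost i j) (δ j k) (δ i h * 1) ⟩
    δ j k * price I (unitCost i j) (δ i h * 1)        ≡⟨ cong (δ j k *_) (price-* I (unitCost i j) (δ i h) 1) ⟩
    δ j k * (δ i h * price I (unitCost i j) 1)        ∎

-- The source of the right-to-left condition: after an occurrence of `j` a descending list has only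
-- entries up to `j`, so all units of `k` lie in the served part.
count-right : ∀ {n} {j k : Fin n} p q → Descending (p ++ q) → 0 < count j p → j <ᶠ k → count k q ≡ 0
count-right {j = j} {k} (x ∷ p) q (x≥ ∷ D) lt j<k with j ≟ x
... | yes refl = count-none {h = k} (All.map (λ y≤j → Fin.<⇒≢ (≤-<-trans y≤j j<k) ∘ sym) (All.++⁻ʳ p x≥))
... | no _     = count-right p q D lt j<k

module _ {m n} (I : CFL m n) where
  open CFL I

  count-clients : ∀ j → count j (clients I) ≡ demand j
  count-clients j = begin
    count j (clients I)                              ≡⟨ count-expand j demand (downFrom n) ⟩
    sum (map (λ i → δ i j * demand i) (downFrom n))  ≡⟨ sum-downFrom (λ i → δ i j * demand i) ⟩
    ∑ℕ (λ i → δ i j * demand i)                      ≡⟨ ∑-δ j demand ⟩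
    demand j                                         ∎
    where open ≡-Reasoning

  count-served : ∀ j l → count j (take l (clients I)) + count j (drop l (clients I)) ≡ demand j
  count-served j l = trans (sym (count-++ j (take l (clients I)) _))
    (trans (cong (count j) (take++drop≡id l (clients I))) (count-clients j))

  plan⇒flow : ∀ {i b t} (P : Plan I i b t) →
              Flow I 1 b t (Plan.opened P) (flow (Plan.servers P) (clients I))
  plan⇒flow {i} {b} {t} P = record
    { used    = λ i j lt → flow-used used (clients I) lt
    ; finite  = λ i j lt → flow-finite assigned lt
    ; covered = λ j → begin
        ∑ℕ (λ i → flow servers (clients I) i j)      ≡⟨ flow-column assigned j ⟩
        count j (take (length servers) (clients I))  ≤⟨ m+n≤o⇒m≤o _ (≤-reflexive (count-served j (length servers))) ⟩
        demand j                                     ≡⟨ *-identityˡ (demand j) ⟨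
        1 * demand j                                 ∎
    ; loads   = λ i → begin
        ∑ℕ (flow servers (clients I) i)              ≡⟨ flow-row assigned i ⟩
        count i servers                              ≤⟨ loads i ⟩
        capacity i                                   ≡⟨ *-identityˡ (capacity i) ⟨
        1 * capacity i                               ∎
    ; prefix  = prefix
    ; total   = trans (flow-total assigned) (trans total (sym (*-identityˡ t)))
    ; budget  = begin
        1 * openings openingCost opened + ∑ℕ (λ i → ∑ℕ (λ j → price I (unitCost i j) (flow servers (clients I) i j)))
          ≡⟨ cong₂ _+_ (*-identityˡ (openings openingCost opened)) (flow-price I assigned) ⟩
        openings openingCost opened + sum payments
          ≤⟨ budget ⟩
        b
          ≡⟨ *-identityˡ b ⟨
        1 * b ∎
    }
    where
    open Plan P
    open ≤-Reasoning

    prefix : ∀ {j k} → j <ᶠ k → 0 < ∑ℕ (λ i → flow servers (clients I) i j) →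
             ∑ℕ (λ i → flow servers (clients I) i k) ≡ 1 * demand k
    prefix {j} {k} j<k lt = begin-equality
      ∑ℕ (λ i → flow servers (clients I) i k)                 ≡⟨ flow-column assigned k ⟩
      count k p                                               ≡⟨ +-identityʳ (count k p) ⟨
      count k p + 0
        ≡⟨ cong (count k p +_) (count-right p q descending (≤-trans lt (≤-reflexive (flow-column assigned j))) j<k) ⟨
      count k p + count k q                                   ≡⟨ count-served k (length servers) ⟩
      demand k                                                ≡⟨ *-identityˡ (demand k) ⟨
      1 * demand k                                            ∎
      where
      p q : List (Fin n)
      p = take (length servers) (clients I)
      q = drop (length servers) (clients I)

      descending : Descending (p ++ q)
      descending = subst Descending (sym (take++drop≡id (length servers) (clients I)))
                     (expand-descending demand (downFrom-descending n))

-- Natural numbers among the rationals and common denominators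

fromℕ-mkℚ : ∀ a → fromℕ a ≡ mkℚ (ℤ.+ a) 0 (Coprime.sym (1-coprimeTo a))
fromℕ-mkℚ a = ℚ.normalize-coprime (Coprime.sym (1-coprimeTo a))

fromℕ-+ : ∀ a b → fromℕ (a + b) ≡ fromℕ a ℚ.+ fromℕ b
-- `fromℕ` of a variable is stuck on the gcd of its normalisation; in constructor form the operation
-- unfolds.
fromℕ-+ a b rewrite fromℕ-mkℚ a | fromℕ-mkℚ b =
  cong (ℚ._/ 1) (sym (cong₂ ℤ._+_ (ℤ.*-identityʳ (ℤ.+ a)) (ℤ.*-identityʳ (ℤ.+ b))))

fromℕ-* : ∀ a b → fromℕ (a * b) ≡ fromℕ a ℚ.* fromℕ b
fromℕ-* a b rewrite fromℕ-mkℚ a | fromℕ-mkℚ b = cong (ℚ._/ 1) (ℤ.pos-* a b)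

fromℕ-mono-≤ : ∀ {a b} → a ≤ b → fromℕ a ℚ.≤ fromℕ b
fromℕ-mono-≤ {a} {b} a≤b rewrite fromℕ-mkℚ a | fromℕ-mkℚ b = *≤* (ℤ.*-monoʳ-≤-nonNeg (ℤ.+ 1) (+≤+ a≤b))

fromℕ-mono-< : ∀ {a b} → a < b → fromℕ a ℚ.< fromℕ b
fromℕ-mono-< {a} {b} a<b rewrite fromℕ-mkℚ a | fromℕ-mkℚ b = *<* (ℤ.*-monoʳ-<-pos (ℤ.+ 1) (+<+ a<b))

fromℕ-cancel-≤ : ∀ a b → fromℕ a ℚ.≤ fromℕ b → a ≤ b
fromℕ-cancel-≤ a b le = ≮⇒≥ (λ b<a → ℚ.<-irrefl refl (ℚ.<-≤-trans (fromℕ-mono-< b<a) le))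

fromℕ-cancel-< : ∀ a b → fromℕ a ℚ.< fromℕ b → a < b
fromℕ-cancel-< a b lt = ≰⇒> (λ b≤a → ℚ.<-irrefl refl (ℚ.<-≤-trans lt (fromℕ-mono-≤ b≤a)))

fromℕ-injective : ∀ a b → fromℕ a ≡ fromℕ b → a ≡ b
fromℕ-injective a b e = ≤-antisym (fromℕ-cancel-≤ a b (ℚ.≤-reflexive e)) (fromℕ-cancel-≤ b a (ℚ.≤-reflexive (sym e)))

fromℕ-positive : ∀ {a} → 0 < a → ℚ.Positive (fromℕ a)
fromℕ-positive lt = ℚ.positive (fromℕ-mono-< lt)

fromℕ-∑ : ∀ {n} (f : Fin n → ℕ) → fromℕ (∑ℕ f) ≡ ∑ℚ (λ i → fromℕ (f i))
fromℕ-∑ {zero}  f = refl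
fromℕ-∑ {suc n} f = trans (fromℕ-+ (f zero) _) (cong (fromℕ (f zero) ℚ.+_) (fromℕ-∑ (f ∘ suc)))

divide : ∀ {d} → 0 < d → ∀ a → ∃[ q ] q ℚ.* fromℕ d ≡ fromℕ a
divide {d} d>0 a = fromℕ a ℚ.* 1/d , (begin
  fromℕ a ℚ.* 1/d ℚ.* fromℕ d     ≡⟨ ℚ.*-assoc (fromℕ a) 1/d (fromℕ d) ⟩
  fromℕ a ℚ.* (1/d ℚ.* fromℕ d)   ≡⟨ cong (fromℕ a ℚ.*_) (ℚ.*-inverseˡ (fromℕ d) {{d≢0}}) ⟩
  fromℕ a ℚ.* 1ℚ                  ≡⟨ ℚ.*-identityʳ (fromℕ a) ⟩
  fromℕ a                         ∎)
  where
  open ≡-Reasoning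
  d≢0 : ℚ.NonZero (fromℕ d)
  d≢0 = ℚ.pos⇒nonZero (fromℕ d) {{fromℕ-positive d>0}}
  1/d : ℚ
  1/d = ℚ.1/_ (fromℕ d) {{d≢0}}

record Clears (q : ℚ) (M : ℕ) : Set where
  constructor _,_
  field
    numerator : ℕ
    cleared   : q ℚ.* fromℕ (suc M) ≡ fromℕ numerator

clears : ∀ {q} → 0ℚ ℚ.≤ q → ∃ (Clears q)
clears {mkℚ (ℤ.+ a) M co} q≥0 = M , a , ℚ.toℚᵘ-injective (begin-equality
  ℚ.toℚᵘ (q ℚ.* fromℕ (suc M))                ≃⟨ ℚ.toℚᵘ-homo-* q (fromℕ (suc M)) ⟩
  ℚ.toℚᵘ q ℚᵘ.* ℚ.toℚᵘ (fromℕ (suc M))        ≡⟨ cong (λ p → ℚ.toℚᵘ q ℚᵘ.* ℚ.toℚᵘ p) (fromℕ-mkℚ (suc M)) ⟩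
  ℚ.toℚᵘ q ℚᵘ.* ℚᵘ.mkℚᵘ (ℤ.+ suc M) 0
    ≃⟨ ℚᵘ.*≡* (trans (ℤ.*-identityʳ _) (cong (λ e → ℤ.+ a ℤ.* ℤ.+ e) (sym (*-identityʳ (suc M))))) ⟩
  ℚᵘ.mkℚᵘ (ℤ.+ a) 0                             ≡⟨ cong ℚ.toℚᵘ (fromℕ-mkℚ a) ⟨
  ℚ.toℚᵘ (fromℕ a)                            ∎)
  where
  open ℚᵘ.≤-Reasoning
  q : ℚ
  q = mkℚ (ℤ.+ a) M co
clears {mkℚ -[1+ a ] M co} (*≤* ())

clears-multiple : ∀ {q M} K → Clears q M → Clears q (K + M * suc K)
clears-multiple {q} {M} K (a , e) = a * suc K , (begin
  q ℚ.* fromℕ (suc M * suc K)                  ≡⟨ cong (q ℚ.*_) (fromℕ-* (suc M) (suc K)) ⟩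
  q ℚ.* (fromℕ (suc M) ℚ.* fromℕ (suc K))      ≡⟨ ℚ.*-assoc q _ _ ⟨
  q ℚ.* fromℕ (suc M) ℚ.* fromℕ (suc K)        ≡⟨ cong (ℚ._* fromℕ (suc K)) e ⟩
  fromℕ a ℚ.* fromℕ (suc K)                    ≡⟨ fromℕ-* a (suc K) ⟨
  fromℕ (a * suc K)                            ∎)
  where open ≡-Reasoning

-- Everything is off by one: the denominators meant are M + 1, K + 1 and
-- suc (K + M * suc K) = suc M * suc K.
common-multiple : ∀ {n} (P : Fin n → ℕ → Set) → (∀ {i M} K → P i M → P i (K + M * suc K)) →
                  (∀ i → ∃ (P i)) → ∃[ M ] (∀ i → P i M)
common-multiple {zero}  P mult each = 0 , λ ()
common-multiple {suc n} P mult each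
  with M , p ← each zero
  with K , ps ← common-multiple (P ∘ suc) mult (each ∘ suc) =
  K + M * suc K , λ where
    zero    → mult K p
    -- Head and tail scale each other's denominators, so the same product arises with its factors in
    -- the opposite order.
    (suc i) → subst (P (suc i)) (suc-injective (*-comm (suc K) (suc M))) (mult M (ps i))

-- Possibly infinite costs, and the passage between solutions and flows

∑∞-[] : ∀ {n} {f : Fin n → ℚ ⁺} {g} → (∀ i → f i ≡ [ g i ]) → ∑ℚ∞ f ≡ [ ∑ℚ g ]
∑∞-[] {zero}  e = refl
∑∞-[] {suc n} e = cong₂ _+ℚ∞_ (e zero) (∑∞-[] (e ∘ suc))

∑∞-finite : ∀ {n} (f : Fin n → ℚ ⁺) {q} → ∑ℚ∞ f ≡ [ q ] → ∀ i → ∃[ g ] f i ≡ [ g ]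
∑∞-finite f {q} e zero with f zero | ∑ℚ∞ (f ∘ suc) | e
... | [ g ] | [ _ ] | _ = g , refl
∑∞-finite f {q} e (suc i) with f zero | ∑ℚ∞ (f ∘ suc) in eq | e
... | [ _ ] | [ _ ] | _ = ∑∞-finite (f ∘ suc) eq i

[]-injective : ∀ {A : Set} {x y : A} → _≡_ {A = A ⁺} [ x ] [ y ] → x ≡ y
[]-injective refl = refl

∑-scaled : ∀ {n} {u : Fin n → ℚ} {y : Fin n → ℕ} {r} → (∀ i → u i ℚ.* r ≡ fromℕ (y i)) →
           ∑ℚ u ℚ.* r ≡ fromℕ (∑ℕ y)
∑-scaled {u = u} {y} {r} e = begin
  ∑ℚ u ℚ.* r                    ≡⟨ ∑ℚ.*-distribʳ-sum r u ⟩
  ∑ℚ (λ i → u i ℚ.* r)          ≡⟨ ∑ℚ.sum-cong-≗ e ⟩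
  ∑ℚ (λ i → fromℕ (y i))        ≡⟨ fromℕ-∑ y ⟨
  fromℕ (∑ℕ y)                  ∎
  where open ≡-Reasoning

+∞-≤ : ∀ {o q B} → [ o ] +ℚ∞ q ≤ℚ∞ [ B ] → ∃[ T ] q ≡ [ T ] × o ℚ.+ T ℚ.≤ B
+∞-≤ {q = [ T ]} AddSupremum.[ le ] = T , refl , le

-- At infinite cost a finite product forces `q` to be 0 by the convention of `_·∞_`, hence `a` to be
-- 0. A positive amount therefore has a finite unit cost, and for amount 0 the price is 0 on both
-- sides.
·∞-scaled : ∀ {m n} (I : CFL m n) c {q r g a} → c ·∞ q ≡ [ g ] → q ℚ.* r ≡ fromℕ a →
            (0 < a → ∃[ w ] c ≡ [ w ]) × g ℚ.* r ≡ fromℕ (price I c a)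
·∞-scaled I ⊤⁺ {q} {r} {a = a} e e′ with q ℚ.≟ 0ℚ
·∞-scaled I ⊤⁺ {q} {r} {a = a} refl e′ | yes refl =
  (λ lt → ⊥-elim (<-irrefl (fromℕ-injective 0 a (trans (sym (ℚ.*-zeroˡ r)) e′)) lt)) , ℚ.*-zeroˡ r
·∞-scaled I [ w ] {q} {r} {a = a} refl e′ = (λ _ → w , refl) , (begin
  fromℕ w ℚ.* q ℚ.* r          ≡⟨ ℚ.*-assoc (fromℕ w) q r ⟩
  fromℕ w ℚ.* (q ℚ.* r)        ≡⟨ cong (fromℕ w ℚ.*_) e′ ⟩
  fromℕ w ℚ.* fromℕ a          ≡⟨ fromℕ-* w a ⟨
  fromℕ (w * a)                ∎)
  where open ≡-Reasoning

·∞-whole : ∀ {m n} (I : CFL m n) c {q a} → (0 < a → ∃[ w ] c ≡ [ w ]) → q ≡ fromℕ a →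
           c ·∞ q ≡ [ fromℕ (price I c a) ]
·∞-whole I ⊤⁺ {a = zero}  _ refl = refl
·∞-whole I ⊤⁺ {a = suc a} fin _ with () ← proj₂ (fin z<s)
·∞-whole I [ w ] {a = a} _ refl = cong [_] (sym (fromℕ-* w a))

fromℕ-nonNeg : ∀ a → ℚ.NonNegative (fromℕ a)
fromℕ-nonNeg a = ℚ.nonNegative (fromℕ-mono-≤ {0} {a} z≤n)

module _ {m n} (I : CFL m n) where
  open CFL I

  module _ (S : Solution I) where
    open Solution S

    -- The amounts `x i j` times `demand j` are cleared rather than the fractions `x i j`, because
    -- the lists are made of parts of units of demand.
    denominator : ∃[ M ] (∀ i j → Clears (x i j ℚ.* fromℕ (demand j)) M)
    denominator = common-multiple (λ i M → ∀ j → Clears (x i j ℚ.* fromℕ (demand j)) M)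
      (λ K cl j → clears-multiple K (cl j))
      (λ i → common-multiple (λ j → Clears (x i j ℚ.* fromℕ (demand j))) clears-multiple (λ j → clears (nonNeg i j)))
      where
      nonNeg : ∀ i j → 0ℚ ℚ.≤ x i j ℚ.* fromℕ (demand j)
      nonNeg i j = ℚ.≤-trans (ℚ.≤-reflexive (sym (ℚ.*-zeroˡ (fromℕ (demand j)))))
        (ℚ.*-monoʳ-≤-nonNeg (fromℕ (demand j)) {{fromℕ-nonNeg (demand j)}} (x≥0 i j))

    solution⇒flow : ∀ {M T b t} → (∀ i j → Clears (x i j ℚ.* fromℕ (demand j)) M) →
      RightToLeft → totalServed ≡ fromℕ t → transportTotal ≡ [ T ] →
      fromℕ openingTotal ℚ.+ T ℚ.≤ fromℕ b → ∃[ y ] Flow I (suc M) b t opened y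
    solution⇒flow {M} {T} {b} {t} cl rtl tot eqT paid = y , record
      { used    = used
      ; finite  = λ i j → proj₁ (priced i j)
      ; covered = λ j → fromℕ-cancel-≤ (∑ℕ (λ i → y i j)) (suc M * demand j) (begin
          fromℕ (∑ℕ (λ i → y i j))                                ≡⟨ column j ⟨
          served j ℚ.* N
            ≡⟨ cong (ℚ._* N) (∑ℚ.*-distribʳ-sum (fromℕ (demand j)) (λ i → x i j)) ⟨
          ∑ℚ (λ i → x i j) ℚ.* fromℕ (demand j) ℚ.* N
            ≤⟨ *N-mono (ℚ.*-monoʳ-≤-nonNeg (fromℕ (demand j)) {{fromℕ-nonNeg (demand j)}} (covered j)) ⟩
          1ℚ ℚ.* fromℕ (demand j) ℚ.* N                           ≡⟨ cong (ℚ._* N) (ℚ.*-identityˡ (fromℕ (demand j))) ⟩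
          fromℕ (demand j) ℚ.* N                                  ≡⟨ *N (demand j) ⟩
          fromℕ (suc M * demand j)                                ∎)
      ; loads   = λ i → fromℕ-cancel-≤ (∑ℕ (y i)) (suc M * capacity i) (begin
          fromℕ (∑ℕ (y i))                                        ≡⟨ ∑-scaled (y-eq i) ⟨
          ∑ℚ (λ j → x i j ℚ.* fromℕ (demand j)) ℚ.* N             ≤⟨ *N-mono (capacities i) ⟩
          fromℕ (capacity i) ℚ.* N                                ≡⟨ *N (capacity i) ⟩
          fromℕ (suc M * capacity i)                              ∎)
      ; prefix  = λ {j} {k} j<k lt → fromℕ-injective (∑ℕ (λ i → y i k)) (suc M * demand k) (begin-equality
          fromℕ (∑ℕ (λ i → y i k))                                ≡⟨ column k ⟨
          served k ℚ.* N                                          ≡⟨ cong (ℚ._* N) (rtl j<k (serving lt)) ⟩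
          fromℕ (demand k) ℚ.* N                                  ≡⟨ *N (demand k) ⟩
          fromℕ (suc M * demand k)                                ∎)
      ; total   = fromℕ-injective (∑ℕ (λ j → ∑ℕ (λ i → y i j))) (suc M * t) (begin-equality
          fromℕ (∑ℕ (λ j → ∑ℕ (λ i → y i j)))                     ≡⟨ ∑-scaled column ⟨
          totalServed ℚ.* N                                       ≡⟨ cong (ℚ._* N) tot ⟩
          fromℕ t ℚ.* N                                           ≡⟨ *N t ⟩
          fromℕ (suc M * t)                                       ∎)
      ; budget  = fromℕ-cancel-≤ (suc M * openingTotal + ∑ℕ (λ i → ∑ℕ (λ j → price I (unitCost i j) (y i j)))) (suc M * b) (begin
          fromℕ (suc M * openingTotal + ∑ℕ (λ i → ∑ℕ (λ j → price I (unitCost i j) (y i j))))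
            ≡⟨ fromℕ-+ (suc M * openingTotal) _ ⟩
          fromℕ (suc M * openingTotal) ℚ.+ fromℕ (∑ℕ (λ i → ∑ℕ (λ j → price I (unitCost i j) (y i j))))
            ≡⟨ cong₂ ℚ._+_ (*N openingTotal) (∑-scaled (λ i → ∑-scaled (λ j → proj₂ (priced i j)))) ⟨
          fromℕ openingTotal ℚ.* N ℚ.+ ∑ℚ (λ i → ∑ℚ (λ j → g i j)) ℚ.* N
            ≡⟨ cong (λ T → fromℕ openingTotal ℚ.* N ℚ.+ T ℚ.* N) ([]-injective (trans (sym (∑∞-[] (λ i → ∑∞-[] (g-eq i)))) eqT)) ⟩
          fromℕ openingTotal ℚ.* N ℚ.+ T ℚ.* N
            ≡⟨ ℚ.*-distribʳ-+ N (fromℕ openingTotal) T ⟨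
          (fromℕ openingTotal ℚ.+ T) ℚ.* N
            ≤⟨ *N-mono paid ⟩
          fromℕ b ℚ.* N
            ≡⟨ *N b ⟩
          fromℕ (suc M * b) ∎)
      }
      where
      open ℚ.≤-Reasoning

      N : ℚ
      N = fromℕ (suc M)

      y : Fin m → Fin n → ℕ
      y i j = Clears.numerator (cl i j)

      y-eq : ∀ i j → x i j ℚ.* fromℕ (demand j) ℚ.* N ≡ fromℕ (y i j)
      y-eq i j = Clears.cleared (cl i j)

      *N : ∀ a → fromℕ a ℚ.* N ≡ fromℕ (suc M * a)
      *N a = trans (sym (fromℕ-* a (suc M))) (cong fromℕ (*-comm a (suc M)))

      *N-mono : ∀ {p q} → p ℚ.≤ q → p ℚ.* N ℚ.≤ q ℚ.* N
      *N-mono = ℚ.*-monoʳ-≤-nonNeg N {{fromℕ-nonNeg (suc M)}}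

      column : ∀ j → served j ℚ.* N ≡ fromℕ (∑ℕ (λ i → y i j))
      column j = ∑-scaled (λ i → y-eq i j)

      serving : ∀ {j} → 0 < ∑ℕ (λ i → y i j) → 0ℚ ℚ.< served j
      serving {j} lt = ℚ.*-cancelʳ-<-nonNeg N {{fromℕ-nonNeg (suc M)}} (begin-strict
        0ℚ ℚ.* N                      ≡⟨ ℚ.*-zeroˡ N ⟩
        fromℕ 0                       <⟨ fromℕ-mono-< lt ⟩
        fromℕ (∑ℕ (λ i → y i j))      ≡⟨ column j ⟨
        served j ℚ.* N                ∎)

      used : ∀ i j → 0 < y i j → i ∈ opened
      used i j lt = x>0⇒opened i j (ℚ.≰⇒> λ x≤0 → <-irrefl (fromℕ-injective 0 (y i j) (begin-equality
        fromℕ 0                                    ≡⟨ ℚ.*-zeroˡ N ⟨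
        0ℚ ℚ.* N                                   ≡⟨ cong (ℚ._* N) (ℚ.*-zeroˡ (fromℕ (demand j))) ⟨
        0ℚ ℚ.* fromℕ (demand j) ℚ.* N
          ≡⟨ cong (λ q → q ℚ.* fromℕ (demand j) ℚ.* N) (ℚ.≤-antisym (x≥0 i j) x≤0) ⟩
        x i j ℚ.* fromℕ (demand j) ℚ.* N           ≡⟨ y-eq i j ⟩
        fromℕ (y i j)                              ∎)) lt)

      -- The total is finite because the budget bounds it, and a finite sum has no infinite term.
      entry : ∀ i j → ∃[ g ] unitCost i j ·∞ (fromℕ (demand j) ℚ.* x i j) ≡ [ g ]
      entry i = ∑∞-finite (λ j → unitCost i j ·∞ (fromℕ (demand j) ℚ.* x i j))
        (proj₂ (∑∞-finite (λ i → ∑ℚ∞ (λ j → unitCost i j ·∞ (fromℕ (demand j) ℚ.* x i j))) eqT i))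

      g : Fin m → Fin n → ℚ
      g i j = proj₁ (entry i j)

      g-eq : ∀ i j → unitCost i j ·∞ (fromℕ (demand j) ℚ.* x i j) ≡ [ g i j ]
      g-eq i j = proj₂ (entry i j)

      priced : ∀ i j → (0 < y i j → ∃[ w ] unitCost i j ≡ [ w ]) ×
               g i j ℚ.* N ≡ fromℕ (price I (unitCost i j) (y i j))
      priced i j = ·∞-scaled I (unitCost i j) (g-eq i j)
        (trans (cong (ℚ._* N) (ℚ.*-comm (fromℕ (demand j)) (x i j))) (y-eq i j))

  module _ {b t O y} (F : Flow I 1 b t O y) (share : Fin m → Fin n → ℚ)
    (share-eq : ∀ i j → share i j ℚ.* fromℕ (demand j) ≡ fromℕ (y i j)) where
    open Flow F
    open ℚ.≤-Reasoning

    private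
      cancel : ∀ j {p q} → p ℚ.* fromℕ (demand j) ℚ.≤ q ℚ.* fromℕ (demand j) → p ℚ.≤ q
      cancel j = ℚ.*-cancelʳ-≤-pos (fromℕ (demand j)) {{fromℕ-positive (demand>0 j)}}

      column≤ : ∀ j → ∑ℕ (λ i → y i j) ≤ demand j
      column≤ j = ≤-trans (covered j) (≤-reflexive (*-identityˡ (demand j)))

      share≤1 : ∀ j {q a} → q ℚ.* fromℕ (demand j) ≡ fromℕ a → a ≤ demand j → q ℚ.≤ 1ℚ
      share≤1 j {q} {a} e le = cancel j (begin
        q ℚ.* fromℕ (demand j)      ≡⟨ e ⟩
        fromℕ a                     ≤⟨ fromℕ-mono-≤ le ⟩
        fromℕ (demand j)            ≡⟨ ℚ.*-identityˡ (fromℕ (demand j)) ⟨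
        1ℚ ℚ.* fromℕ (demand j)     ∎)

      ∑-whole : ∀ {k} {u : Fin k → ℚ} {z : Fin k → ℕ} → (∀ i → u i ≡ fromℕ (z i)) → ∑ℚ u ≡ fromℕ (∑ℕ z)
      ∑-whole {z = z} e = trans (∑ℚ.sum-cong-≗ e) (sym (fromℕ-∑ z))

      ∑-term : ∀ {k} (z : Fin k → ℕ) i → z i ≤ ∑ℕ z
      ∑-term z zero    = m≤m+n (z zero) _
      ∑-term z (suc i) = ≤-trans (∑-term (z ∘ suc) i) (m≤n+m _ (z zero))

    -- Bounds on the fractions are verified after multiplication by the positive demand, which turns
    -- them into statements about the whole numbers `y`.
    flow-solution : Solution I
    flow-solution = record
      { opened     = O
      ; x          = share
      ; x≥0        = λ i j → cancel j (begin
          0ℚ ℚ.* fromℕ (demand j)           ≡⟨ ℚ.*-zeroˡ (fromℕ (demand j)) ⟩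
          fromℕ 0                           ≤⟨ fromℕ-mono-≤ {0} {y i j} z≤n ⟩
          fromℕ (y i j)                     ≡⟨ share-eq i j ⟨
          share i j ℚ.* fromℕ (demand j)    ∎)
      ; x≤1        = λ i j → share≤1 j (share-eq i j) (≤-trans (∑-term (λ i → y i j) i) (column≤ j))
      ; x>0⇒opened = λ i j x>0 → used i j (fromℕ-cancel-< 0 (y i j) (begin-strict
          fromℕ 0                           ≡⟨ ℚ.*-zeroˡ (fromℕ (demand j)) ⟨
          0ℚ ℚ.* fromℕ (demand j)           <⟨ ℚ.*-monoˡ-<-pos (fromℕ (demand j)) {{fromℕ-positive (demand>0 j)}} x>0 ⟩
          share i j ℚ.* fromℕ (demand j)    ≡⟨ share-eq i j ⟩
          fromℕ (y i j)                     ∎))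
      ; covered    = λ j → share≤1 j (∑-scaled (λ i → share-eq i j)) (column≤ j)
      ; capacities = λ i → begin
          ∑ℚ (λ j → share i j ℚ.* fromℕ (demand j))    ≡⟨ ∑-whole (share-eq i) ⟩
          fromℕ (∑ℕ (y i))                             ≤⟨ fromℕ-mono-≤ (loads i) ⟩
          fromℕ (1 * capacity i)                       ≡⟨ cong fromℕ (*-identityˡ (capacity i)) ⟩
          fromℕ (capacity i)                           ∎
      }

    open Solution flow-solution using (served; totalServed; transportTotal; cost; openingTotal)

    private
      served-eq : ∀ j → served j ≡ fromℕ (∑ℕ (λ i → y i j))
      served-eq j = ∑-whole (λ i → share-eq i j)

    flow-rightToLeft : Solution.RightToLeft flow-solution
    flow-rightToLeft {j} {k} j<k lt = begin-equality
      served k                      ≡⟨ served-eq k ⟩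
      fromℕ (∑ℕ (λ i → y i k))
        ≡⟨ cong fromℕ (prefix j<k (fromℕ-cancel-< 0 (∑ℕ (λ i → y i j)) (ℚ.<-≤-trans lt (ℚ.≤-reflexive (served-eq j))))) ⟩
      fromℕ (1 * demand k)          ≡⟨ cong fromℕ (*-identityˡ (demand k)) ⟩
      fromℕ (demand k)              ∎

    flow-totalServed : totalServed ≡ fromℕ t
    flow-totalServed = trans (∑-whole served-eq) (cong fromℕ (trans total (*-identityˡ t)))

    flow-cost : cost ≤ℚ∞ [ fromℕ b ]
    flow-cost = subst (_≤ℚ∞ [ fromℕ b ]) (sym (cong ([ fromℕ openingTotal ] +ℚ∞_) transport)) AddSupremum.[ (begin
      fromℕ openingTotal ℚ.+ ∑ℚ (λ i → ∑ℚ (λ j → fromℕ (price I (unitCost i j) (y i j))))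
        ≡⟨ cong (fromℕ openingTotal ℚ.+_) (∑-whole (λ i → sym (fromℕ-∑ (λ j → price I (unitCost i j) (y i j))))) ⟩
      fromℕ openingTotal ℚ.+ fromℕ (∑ℕ (λ i → ∑ℕ (λ j → price I (unitCost i j) (y i j))))
        ≡⟨ fromℕ-+ openingTotal _ ⟨
      fromℕ (openingTotal + ∑ℕ (λ i → ∑ℕ (λ j → price I (unitCost i j) (y i j))))
        ≤⟨ fromℕ-mono-≤ (≤-trans (+-monoˡ-≤ _ (≤-reflexive (sym (*-identityˡ openingTotal)))) (≤-trans budget (≤-reflexive (*-identityˡ b)))) ⟩
      fromℕ b ∎) ]
      where
      transport : transportTotal ≡ [ ∑ℚ (λ i → ∑ℚ (λ j → fromℕ (price I (unitCost i j) (y i j)))) ]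
      transport = ∑∞-[] (λ i → ∑∞-[] (λ j → ·∞-whole I (unitCost i j) (finite i j)
        (trans (ℚ.*-comm (fromℕ (demand j)) (share i j)) (share-eq i j))))

  servable⇒plan : Monge I → ∀ {i b t} → Servable I i b t → Plan I (toℕ i) b t
  servable⇒plan monge (S , from , rtl , tot , cost≤) =
    flow⇒plan I monge (proj₂ (solution⇒flow S (proj₂ (denominator S)) rtl tot (proj₁ (proj₂ (+∞-≤ cost≤))) (proj₂ (proj₂ (+∞-≤ cost≤))))) from

  plan⇒servable : ∀ {i b t} → Plan I (toℕ i) b t → Servable I i b t
  plan⇒servable {b = b} {t} P = flow-solution F share share-eq , Plan.from P ,
    flow-rightToLeft F share share-eq , flow-totalServed F share share-eq , flow-cost F share share-eq
    where
    y : Fin m → Fin n → ℕ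
    y = flow (Plan.servers P) (clients I)

    F : Flow I 1 b t (Plan.opened P) y
    F = plan⇒flow I P

    share : Fin m → Fin n → ℚ
    share i j = proj₁ (divide (demand>0 j) (y i j))

    share-eq : ∀ i j → share i j ℚ.* fromℕ (demand j) ≡ fromℕ (y i j)
    share-eq i j = proj₂ (divide (demand>0 j) (y i j))

-- The recursion for solutions and the existence of the maxima

theorem2 : ∀ {m n : ℕ} (I : CFL m n) → Monge I →
    (∀ i b → ∃ (IsMaximum (Servable I i b))) ×
    (∀ (V : Fin (suc m) → ℕ → ℕ) → (∀ i b → IsMaximum (Servable I i b) (V i b)) →
    (∀ b → V (lastFin m) b ≡ 0) ×
    (∀ (i : Fin m) b →
    V (inject₁ i) b ≡
    max 0 (map (λ b' → V (suc i) b' + DM I i (V (suc i) b') (b ∸ b')) (upTo (suc b)))))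
theorem2 {m} {n} I monge = existence , λ V V-max →
  (λ b → maximum-unique (V-max (lastFin m) b) (base b)) ,
  (λ i b → maximum-unique (V-max (inject₁ i) b) (step i b (V-max (suc i))))
  where
  base : ∀ b → IsMaximum (Servable I (lastFin m) b) 0
  base b = maximum-cong plan⇒servable′ (servable⇒plan I monge)
    (subst (λ k → IsMaximum (Plan I k b) 0) (sym (Fin.toℕ-fromℕ m)) (last-plan I b))
    where
    plan⇒servable′ : ∀ {t} → Plan I (toℕ (lastFin m)) b t → Servable I (lastFin m) b t
    plan⇒servable′ = plan⇒servable I

  step : ∀ (i : Fin m) b {v : ℕ → ℕ} → (∀ b′ → IsMaximum (Servable I (suc i) b′) (v b′)) →
         IsMaximum (Servable I (inject₁ i) b)
           (max 0 (map (λ b′ → v b′ + DM I i (v b′) (b ∸ b′)) (upTo (suc b))))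
  step i b {v} v-max = maximum-cong (plan⇒servable I) (servable⇒plan I monge)
    (subst (λ k → IsMaximum (Plan I k b) (max 0 (map (λ b′ → v b′ + DM I i (v b′) (b ∸ b′)) (upTo (suc b)))))
      (sym (Fin.toℕ-inject₁ i))
      (recursion I monge i b (λ b′ → maximum-cong (servable⇒plan I monge) (plan⇒servable I) (v-max b′))))

  -- `Servable` quantifies over rational solutions, so a bound on `t` does not by itself produce a
  -- maximum constructively. The recursion does: it computes each maximum from those with one
  -- facility fewer, starting from none.
  existence : ∀ i b → ∃ (IsMaximum (Servable I i b))
  existence = >-weakInduction (λ i → ∀ b → ∃ (IsMaximum (Servable I i b)))
    (λ b → 0 , base b)
    (λ i v b → _ , step i b (λ b′ → proj₂ (v b′)))
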